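{- Let $\phi\colon G'\to G$ be a covering map of digraphs such that every vertex and every edge of $G$ has exactly $d$ preimages, and let $\mathcal F$ be a sheaf on $G$. Then ${\rm m.e.}(\phi^*\mathcal F)=d\cdot{\rm m.e.}(\mathcal F)$. Moreover, if the maximum excess of $\mathcal F$ is attained at $U=\bigoplus_{v\in V_G}U_v\subset\mathcal F(V)$ (with $U_v\subset\mathcal F(v)$), then the maximum excess of $\phi^*\mathcal F$ is attained at $\phi^{ -1}(U)=\bigoplus_{v'\in V_{G'}}U_{\phi(v')}$.
   Context: Digraphs are finite, with tail/head maps, multiple edges and loops allowed. A sheaf $\mathcal F$ on $G$: finite-dimensional $\mathbb F$-vector spaces $\mathcal F(P)$, $P\in V_G\sqcup E_G$, with linear maps $\mathcal F(t,e)\colon\mathcal F(e)\to\mathcal F(t_Ge)$, $\mathcal F(h,e)\colon\mathcal F(e)\to\mathcal F(h_Ge)$; $\mathcal F(V)=\bigoplus_v\mathcal F(v)$, $\mathcal F(E)=\bigoplus_e\mathcal F(e)$; $d_h,d_t\colon\mathcal F(E)\to\mathcal F(V)$ send the summand $\mathcal F(e)$ into $\mathcal F(h_Ge)$ resp. $\mathcal F(t_Ge)$ via the restriction maps. For a subspace $U\subset\mathcal F(V)$, $\Gamma_{\rm ht}(U)=\bigoplus_e\{w\in\mathcal F(e):d_hw\in U,\ d_tw\in U\}$, ${\rm excess}(\mathcal F,U)=\dim\Gamma_{\rm ht}(U)-\dim U$, ${\rm m.e.}(\mathcal F)=\max_U{\rm excess}(\mathcal F,U)$. A covering map $\phi\colon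 G'\to G$ is a digraph morphism mapping, for each vertex $v$, the edges with head $v$ bijectively onto those with head $\phi(v)$ and the edges with tail $v$ bijectively onto those with tail $\phi(v)$. The pullback $\phi^*\mathcal F$ has values $\mathcal F(\phi(P))$ and restriction maps $\mathcal F(h,\phi(e)),\mathcal F(t,\phi(e))$. -}

module Defs where

open import Level using (Level; Setω; suc)
open import Algebra.Bundles using (CommutativeRing; Ring)
open import Algebra.Apartness.Bundles using (HeytingField; HeytingCommutativeRing)
open import Algebra.Module.Bundles using (LeftModule)
open import Algebra.Module.Morphism.Structures using (IsLeftModuleHomomorphism)
open import Axiom.ExcludedMiddle using (ExcludedMiddle)
open import Data.Fin.Base using (Fin)
import Data.Fin.Properties as Fin
open import Data.Integer.Base using (ℤ; +_; _-_; _≤_)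
open import Data.Nat.Base using (ℕ; zero)
open import Data.Product.Base using (∃-syntax; _×_; _,_; proj₁; proj₂)
open import Data.Unit.Polymorphic.Base using (⊤; tt)
open import Function.Base using (_∘_)
open import Function.Bundles using (_↔_; Inverse)
open import Function.Definitions using (Bijective)
open import Function.Properties.Inverse using (↔⇒↣)
open import Relation.Binary.Definitions using (DecidableEquality; _Respects_)
open import Relation.Binary.PropositionalEquality.Core using (_≡_; refl; sym; trans; cong; subst)
open import Relation.Nullary.Decidable using (via-injection)
open import Relation.Nullary.Decidable.Core using (Dec; yes; no)
open import Relation.Unary using (Pred)
import Algebra.Module.Properties.LeftModule as LeftModuleProperties
import Algebra.Module.Morphism.Construct.Composition as Composition
import Algebra.Properties.CommutativeMonoid.Sum as Sum

Classical : Setω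
Classical = ∀ {ℓ : Level} → ExcludedMiddle ℓ

Finite : Set → Set
Finite A = ∃[ n ] (A ↔ Fin n)

≡-dec : {A : Set} → Finite A → DecidableEquality A
≡-dec (_ , A↔Fin) = via-injection (↔⇒↣ A↔Fin) Fin._≟_

record Digraph : Set₁ where
  field
    Vertex       : Set
    Edge         : Set
    finiteVertex : Finite Vertex
    finiteEdge   : Finite Edge
    tail head    : Edge → Vertex

record Morphism (G′ G : Digraph) : Set where
  private
    module G′ = Digraph G′
    module G  = Digraph G
  field
    onVertex : G′.Vertex → G.Vertex
    onEdge   : G′.Edge → G.Edge
    tail-com : ∀ e → onVertex (G′.tail e) ≡ G.tail (onEdge e)
    head-com : ∀ e → onVertex (G′.head e) ≡ G.head (onEdge e)

  onHeads : ∀ v → (∃[ e ] G′.head e ≡ v) → ∃[ e ] G.head e ≡ onVertex v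
  onHeads v (e , p) = onEdge e , trans (sym (head-com e)) (cong onVertex p)

  onTails : ∀ v → (∃[ e ] G′.tail e ≡ v) → ∃[ e ] G.tail e ≡ onVertex v
  onTails v (e , p) = onEdge e , trans (sym (tail-com e)) (cong onVertex p)

record IsCovering {G′ G : Digraph} (φ : Morphism G′ G) : Set where
  open Morphism φ
  field
    heads-bijective : ∀ v → Bijective _≡_ _≡_ (onHeads v)
    tails-bijective : ∀ v → Bijective _≡_ _≡_ (onTails v)

Fibre : {A B : Set} → (A → B) → B → Set
Fibre f b = ∃[ a ] f a ≡ b

-- In the presence of excluded middle, tightness makes the apartness of a
-- Heyting field coincide with _≉_, so that Heyting fields are exactly fields
-- (0# ≉ 1# follows from invertible⇒# and irreflexivity).

module _ {ℓ : Level} (𝔽 : HeytingField ℓ ℓ ℓ) where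

  open HeytingField 𝔽 using () renaming (Carrier to Scalar; _≈_ to _≈ˢ_; 0# to 0ˢ)

  scalarRing : Ring ℓ ℓ
  scalarRing = CommutativeRing.ring (HeytingCommutativeRing.commutativeRing
                 (HeytingField.heytingCommutativeRing 𝔽))

  VectorSpace : Set (suc ℓ)
  VectorSpace = LeftModule scalarRing ℓ ℓ

  ∣_∣ : VectorSpace → Set ℓ
  ∣ M ∣ = LeftModule.Carrierᴹ M

  record LinearMap (M N : VectorSpace) : Set ℓ where
    private
      module M = LeftModule M
      module N = LeftModule N
    field
      ⟦_⟧      : ∣ M ∣ → ∣ N ∣
      isLinear : IsLeftModuleHomomorphism M.rawLeftModule N.rawLeftModule ⟦_⟧
    open IsLeftModuleHomomorphism isLinear public

  open LinearMap using (⟦_⟧)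

  record Subspace (M : VectorSpace) : Set (suc ℓ) where
    open LeftModule M
    field
      Contains : Pred Carrierᴹ ℓ
      ∈-resp-≈ : Contains Respects _≈ᴹ_
      0ᴹ-∈     : Contains 0ᴹ
      +ᴹ-∈     : ∀ {x y} → Contains x → Contains y → Contains (x +ᴹ y)
      *ₗ-∈     : ∀ a {x} → Contains x → Contains (a *ₗ x)

  open Subspace using (Contains)

  whole : (M : VectorSpace) → Subspace M
  whole M = record
    { Contains = λ _ → ⊤
    ; ∈-resp-≈ = λ _ _ → tt
    ; 0ᴹ-∈     = tt
    ; +ᴹ-∈     = λ _ _ → tt
    ; *ₗ-∈     = λ _ _ → tt
    }

  _∩_ : {M : VectorSpace} → Subspace M → Subspace M → Subspace M
  U ∩ W = record
    { Contains = λ x → Contains U x × Contains W x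
    ; ∈-resp-≈ = λ x≈y (u , w) → U.∈-resp-≈ x≈y u , W.∈-resp-≈ x≈y w
    ; 0ᴹ-∈     = U.0ᴹ-∈ , W.0ᴹ-∈
    ; +ᴹ-∈     = λ (u , w) (u′ , w′) → U.+ᴹ-∈ u u′ , W.+ᴹ-∈ w w′
    ; *ₗ-∈     = λ a (u , w) → U.*ₗ-∈ a u , W.*ₗ-∈ a w
    }
    where
    module U = Subspace U
    module W = Subspace W

  preimage : {M N : VectorSpace} → LinearMap M N → Subspace N → Subspace M
  preimage {M} {N} f U = record
    { Contains = λ x → Contains U (⟦ f ⟧ x)
    ; ∈-resp-≈ = λ x≈y → U.∈-resp-≈ (f.⟦⟧-cong x≈y)
    ; 0ᴹ-∈     = U.∈-resp-≈ (N.≈ᴹ-sym f.0ᴹ-homo) U.0ᴹ-∈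
    ; +ᴹ-∈     = λ p q → U.∈-resp-≈ (N.≈ᴹ-sym (f.+ᴹ-homo _ _)) (U.+ᴹ-∈ p q)
    ; *ₗ-∈     = λ a p → U.∈-resp-≈ (N.≈ᴹ-sym (f.*ₗ-homo a _)) (U.*ₗ-∈ a p)
    }
    where
    module f = LinearMap f
    module U = Subspace U
    module N = LeftModule N

  module _ (M : VectorSpace) where
    open LeftModule M
    open Sum +ᴹ-commutativeMonoid using (sum)

    linComb : ∀ {k} → (Fin k → Scalar) → (Fin k → Carrierᴹ) → Carrierᴹ
    linComb c b = sum (λ i → c i *ₗ b i)

    record IsBasis (U : Subspace M) {k : ℕ} (b : Fin k → Carrierᴹ) : Set ℓ where
      field
        inside      : ∀ i → Contains U (b i)
        independent : ∀ c → linComb c b ≈ᴹ 0ᴹ → ∀ i → c i ≈ˢ 0ˢ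
        spanning    : ∀ x → Contains U x → ∃[ c ] x ≈ᴹ linComb c b

  HasDim : {M : VectorSpace} → Subspace M → ℕ → Set ℓ
  HasDim {M} U k = ∃[ b ] IsBasis M U {k} b

  FiniteDimensional : VectorSpace → Set ℓ
  FiniteDimensional M = ∃[ k ] HasDim (whole M) k

  module _ {M N : VectorSpace} where
    private
      module M = LeftModule M
      module N = LeftModule N
      module NP = LeftModuleProperties N

    mkLinear : (f : ∣ M ∣ → ∣ N ∣) →
               (∀ {x y} → x M.≈ᴹ y → f x N.≈ᴹ f y) →
               (∀ x y → f (x M.+ᴹ y) N.≈ᴹ (f x N.+ᴹ f y)) →
               (∀ a x → f (a M.*ₗ x) N.≈ᴹ (a N.*ₗ f x)) →
               LinearMap M N
    mkLinear f f-cong f-+ f-* = record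
      { ⟦_⟧      = f
      ; isLinear = record
        { +ᴹ-isGroupHomomorphism = record
          { isMonoidHomomorphism = record
            { isMagmaHomomorphism = record
              { isRelHomomorphism = record { cong = f-cong }
              ; homo = f-+
              }
            ; ε-homo = f-0
            }
          ; ⁻¹-homo = λ x → NP.inverseˡ-uniqueᴹ _ _
              (N.≈ᴹ-trans (N.≈ᴹ-sym (f-+ _ _)) (N.≈ᴹ-trans (f-cong (M.-ᴹ‿inverseˡ x)) f-0))
          }
        ; *ₗ-homo = f-*
        }
      }
      where
      f-0 : f M.0ᴹ N.≈ᴹ N.0ᴹ
      f-0 = N.≈ᴹ-trans (f-cong (M.≈ᴹ-sym (M.*ₗ-zeroˡ M.0ᴹ)))
              (N.≈ᴹ-trans (f-* 0ˢ M.0ᴹ) (N.*ₗ-zeroˡ (f M.0ᴹ)))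

  _∘ₗ_ : {L M N : VectorSpace} → LinearMap M N → LinearMap L M → LinearMap L N
  _∘ₗ_ {N = N} g f = record
    { ⟦_⟧      = ⟦ g ⟧ ∘ ⟦ f ⟧
    ; isLinear = Composition.isLeftModuleHomomorphism (LeftModule.≈ᴹ-trans N)
                   (LinearMap.isLinear f) (LinearMap.isLinear g)
    }

  -- A finite direct sum is modelled by the pointwise product.

  ⨁ : {I : Set} → (I → VectorSpace) → VectorSpace
  ⨁ {I} M = record
    { Carrierᴹ = ∀ i → ∣ M i ∣
    ; _≈ᴹ_     = λ x y → ∀ i → M._≈ᴹ_ i (x i) (y i)
    ; _+ᴹ_     = λ x y i → M._+ᴹ_ i (x i) (y i)
    ; _*ₗ_     = λ a x i → M._*ₗ_ i a (x i)
    ; 0ᴹ       = λ i → M.0ᴹ i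
    ; -ᴹ_      = λ x i → M.-ᴹ_ i (x i)
    ; isLeftModule = record
      { isLeftSemimodule = record
        { +ᴹ-isCommutativeMonoid = record
          { isMonoid = record
            { isSemigroup = record
              { isMagma = record
                { isEquivalence = record
                  { refl  = λ i → M.≈ᴹ-refl i
                  ; sym   = λ p i → M.≈ᴹ-sym i (p i)
                  ; trans = λ p q i → M.≈ᴹ-trans i (p i) (q i)
                  }
                ; ∙-cong = λ p q i → M.+ᴹ-cong i (p i) (q i)
                }
              ; assoc = λ x y z i → M.+ᴹ-assoc i (x i) (y i) (z i)
              }
            ; identity = (λ x i → M.+ᴹ-identityˡ i (x i)) , (λ x i → M.+ᴹ-identityʳ i (x i))
            }
          ; comm = λ x y i → M.+ᴹ-comm i (x i) (y i)
          }
        ; isPreleftSemimodule = record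
          { *ₗ-cong      = λ p q i → M.*ₗ-cong i p (q i)
          ; *ₗ-zeroˡ     = λ x i → M.*ₗ-zeroˡ i (x i)
          ; *ₗ-distribʳ  = λ x a b i → M.*ₗ-distribʳ i (x i) a b
          ; *ₗ-identityˡ = λ x i → M.*ₗ-identityˡ i (x i)
          ; *ₗ-assoc     = λ a b x i → M.*ₗ-assoc i a b (x i)
          ; *ₗ-zeroʳ     = λ a i → M.*ₗ-zeroʳ i a
          ; *ₗ-distribˡ  = λ a x y i → M.*ₗ-distribˡ i a (x i) (y i)
          }
        }
      ; -ᴹ‿cong    = λ p i → M.-ᴹ‿cong i (p i)
      ; -ᴹ‿inverse = (λ x i → M.-ᴹ‿inverseˡ i (x i)) , (λ x i → M.-ᴹ‿inverseʳ i (x i))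
      }
    }
    where module M i = LeftModule (M i)

  ⨁ˢ : {I : Set} {M : I → VectorSpace} → (∀ i → Subspace (M i)) → Subspace (⨁ M)
  ⨁ˢ U = record
    { Contains = λ x → ∀ i → Contains (U i) (x i)
    ; ∈-resp-≈ = λ x≈y p i → U.∈-resp-≈ i (x≈y i) (p i)
    ; 0ᴹ-∈     = λ i → U.0ᴹ-∈ i
    ; +ᴹ-∈     = λ p q i → U.+ᴹ-∈ i (p i) (q i)
    ; *ₗ-∈     = λ a p i → U.*ₗ-∈ i a (p i)
    }
    where module U i = Subspace (U i)

  module _ {I : Set} (fin : Finite I) (M : I → VectorSpace) where
    private
      module M i = LeftModule (M i)

    place : (i j : I) → Dec (i ≡ j) → ∣ M i ∣ → ∣ M j ∣
    place i .i (yes refl) x = x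
    place i j  (no _)     x = M.0ᴹ j

    inject : (i : I) → LinearMap (M i) (⨁ M)
    inject i = mkLinear {N = ⨁ M} (λ x j → place i j (i ≟ j) x)
      (λ x≈y j → place-cong j (i ≟ j) x≈y)
      (λ x y j → place-+ j (i ≟ j) x y)
      (λ a x j → place-* j (i ≟ j) a x)
      where
      _≟_ = ≡-dec fin

      place-cong : ∀ j (i≟j : Dec (i ≡ j)) {x y} → M._≈ᴹ_ i x y →
                   M._≈ᴹ_ j (place i j i≟j x) (place i j i≟j y)
      place-cong .i (yes refl) x≈y = x≈y
      place-cong j  (no _)     _   = M.≈ᴹ-refl j

      place-+ : ∀ j (i≟j : Dec (i ≡ j)) x y →
                M._≈ᴹ_ j (place i j i≟j (M._+ᴹ_ i x y))
                         (M._+ᴹ_ j (place i j i≟j x) (place i j i≟j y))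
      place-+ .i (yes refl) x y = M.≈ᴹ-refl i
      place-+ j  (no _)     _ _ = M.≈ᴹ-sym j (M.+ᴹ-identityˡ j (M.0ᴹ j))

      place-* : ∀ j (i≟j : Dec (i ≡ j)) a x →
                M._≈ᴹ_ j (place i j i≟j (M._*ₗ_ i a x)) (M._*ₗ_ j a (place i j i≟j x))
      place-* .i (yes refl) a x = M.≈ᴹ-refl i
      place-* j  (no _)     a _ = M.≈ᴹ-sym j (M.*ₗ-zeroʳ j a)

    copair : {N : VectorSpace} → (∀ i → LinearMap (M i) N) → LinearMap (⨁ M) N
    copair {N} f = mkLinear {M = ⨁ M} (λ x → sum (λ k → ⟦ f (elem k) ⟧ (x (elem k))))
      (λ x≈y → sum-cong-≋ (λ k → f.⟦⟧-cong (elem k) (x≈y (elem k))))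
      (λ x y → N.≈ᴹ-trans
        (sum-cong-≋ (λ k → f.+ᴹ-homo (elem k) (x (elem k)) (y (elem k))))
        (∑-distrib-+ (λ k → ⟦ f (elem k) ⟧ (x (elem k))) (λ k → ⟦ f (elem k) ⟧ (y (elem k)))))
      (λ a x → N.≈ᴹ-trans
        (sum-cong-≋ (λ k → f.*ₗ-homo (elem k) a (x (elem k))))
        (sum-* a (λ k → ⟦ f (elem k) ⟧ (x (elem k)))))
      where
      module N = LeftModule N
      module f i = LinearMap (f i)
      open Sum N.+ᴹ-commutativeMonoid using (sum; sum-cong-≋; ∑-distrib-+)

      elem : Fin (proj₁ fin) → I
      elem = Inverse.from (proj₂ fin)

      sum-* : ∀ {n} a (y : Fin n → ∣ N ∣) → sum (λ k → a N.*ₗ y k) N.≈ᴹ (a N.*ₗ sum y)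
      sum-* {zero}  a y = N.≈ᴹ-sym (N.*ₗ-zeroʳ a)
      sum-* {ℕ.suc n} a y = N.≈ᴹ-trans
        (N.+ᴹ-cong N.≈ᴹ-refl (sum-* a (y ∘ Fin.suc)))
        (N.≈ᴹ-sym (N.*ₗ-distribˡ a (y Fin.zero) (sum (y ∘ Fin.suc))))

  record Sheaf (G : Digraph) : Set (suc ℓ) where
    open Digraph G
    field
      atVertex        : Vertex → VectorSpace
      atEdge          : Edge → VectorSpace
      finDim-atVertex : ∀ v → FiniteDimensional (atVertex v)
      finDim-atEdge   : ∀ e → FiniteDimensional (atEdge e)
      restrictTail    : ∀ e → LinearMap (atEdge e) (atVertex (tail e))
      restrictHead    : ∀ e → LinearMap (atEdge e) (atVertex (head e))

  pullback : {G′ G : Digraph} → Morphism G′ G → Sheaf G → Sheaf G′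
  pullback φ F = record
    { atVertex        = λ v → F.atVertex (φ.onVertex v)
    ; atEdge          = λ e → F.atEdge (φ.onEdge e)
    ; finDim-atVertex = λ v → F.finDim-atVertex (φ.onVertex v)
    ; finDim-atEdge   = λ e → F.finDim-atEdge (φ.onEdge e)
    ; restrictTail    = λ e → subst (λ v → LinearMap (F.atEdge (φ.onEdge e)) (F.atVertex v))
                          (sym (φ.tail-com e)) (F.restrictTail (φ.onEdge e))
    ; restrictHead    = λ e → subst (λ v → LinearMap (F.atEdge (φ.onEdge e)) (F.atVertex v))
                          (sym (φ.head-com e)) (F.restrictHead (φ.onEdge e))
    }
    where
    module φ = Morphism φ
    module F = Sheaf F

  module _ {G : Digraph} (F : Sheaf G) where
    open Digraph G
    open Sheaf F

    vertexSum edgeSum : VectorSpace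
    vertexSum = ⨁ atVertex
    edgeSum   = ⨁ atEdge

    d-head d-tail : LinearMap edgeSum vertexSum
    d-head = copair finiteEdge atEdge
               (λ e → inject finiteVertex atVertex (head e) ∘ₗ restrictHead e)
    d-tail = copair finiteEdge atEdge
               (λ e → inject finiteVertex atVertex (tail e) ∘ₗ restrictTail e)

    Γht : Subspace vertexSum → Subspace edgeSum
    Γht U = ⨁ˢ (λ e → preimage (d-head ∘ₗ inject finiteEdge atEdge e) U
                    ∩ preimage (d-tail ∘ₗ inject finiteEdge atEdge e) U)

    -- Dimension is a function of the subspace only by excluded middle, so
    -- excess and maximum excess are given as functional relations.
    HasExcess : Subspace vertexSum → ℤ → Set ℓ
    HasExcess U x = ∃[ a ] ∃[ b ] HasDim (Γht U) a × HasDim U b × x ≡ + a - + b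

    IsMaxExcess : ℤ → Set (suc ℓ)
    IsMaxExcess m = (∃[ U ] HasExcess U m) × (∀ U x → HasExcess U x → x ≤ m)

    MaxExcessAttainedAt : Subspace vertexSum → Set (suc ℓ)
    MaxExcessAttainedAt U = ∃[ m ] IsMaxExcess m × HasExcess U m

-- Only direct sums of vertex subspaces U_v matter, and on these the excess is supermodular, by the
-- modular law for dimensions. Hence families of maximal excess are closed under sums, and there is
-- a largest one, which is invariant under every automorphism of the sheaf. On the Galois closure
-- of the cover, whose sheets are all d! permutations of the d sheets, the automorphism group is
-- transitive on fibres, so the largest family is a pullback from G and the maximum excess there is
-- d! m.e.(F). A family on G′ pulls back to the Galois closure along each of the d projections
-- p ↦ p i; summing the d resulting bounds and dividing by d! gives excess ≤ d m.e.(F) on G′, and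
-- pulling back a maximal family from G attains it.

module Submission where

open import Defs
open import Level using (Level)
open import Algebra.Apartness.Bundles using (HeytingField)
open import Algebra.Module.Bundles using (LeftModule)
import Algebra.Properties.CommutativeMonoid.Sum as Sum
open import Data.Fin.Base using (Fin; zero; suc; combine; punchIn; _↑ˡ_; _↑ʳ_)
open import Data.Fin.Permutation as Perm using (Permutation′; _⟨$⟩ʳ_; _∘ₚ_)
open import Data.Fin.Properties using (*↔×; punchIn-injective; suc-injective)
open import Data.Integer.Base as ℤ using (ℤ)
import Data.Integer.Properties as ℤ
open import Data.Nat.Base as ℕ using (ℕ; zero; suc; _+_; _∸_; _≤_; _<_; z≤n; s≤s; s≤s⁻¹)
import Data.Nat.Properties as ℕ
open import Data.Product.Base using (∃-syntax; _×_; _,_; proj₁; proj₂)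
open import Data.Product.Function.NonDependent.Propositional using (_×-↔_)
open import Data.Unit.Base using (⊤; tt)
open import Data.Vec.Functional using () renaming (_∷_ to _∷ᶠ_)
open import Function.Base using (_∘_; id)
open import Function.Bundles using (_↔_; Inverse; mk↔ₛ′)
open import Function.Construct.Composition using (_↔-∘_)
open import Function.Construct.Identity using (↔-id)
open import Function.Construct.Symmetry using (↔-sym)
open import Function.Definitions using (Bijective)
open import Relation.Binary.PropositionalEquality
  using (_≡_; _≢_; refl; sym; trans; cong; cong₂; subst; subst₂; dcong; module ≡-Reasoning)
import Relation.Binary.Reasoning.Setoid as SetoidReasoning
open import Relation.Nullary.Decidable.Core using (yes; no; decidable-stable)
open import Relation.Nullary.Negation.Core using (¬_; contradiction)

-- A cover need not have any nontrivial automorphism over G, so no symmetry argument is available on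
-- G′ itself; this is what forces the passage to permutations of the sheets. There the monodromy
-- composes on one side and the translations on the other. The two commute, which makes every
-- translation an automorphism, and any permutation is carried to any other by a translation. An
-- automorphism only permutes the families of maximal excess, so invariance needs a canonical one:
-- hence the largest.
--
-- Two choices of form run through the proof. Excess is kept as a pair of natural numbers and
-- compared by adding crosswise, so integers occur only where `HasExcess` is met. Dimension is the
-- length of a flag of one subspace over another, so the isomorphism theorems are available without
-- quotient spaces.

private module ∑ = Sum ℕ.+-0-commutativeMonoid
open ∑ using (sum)

-- Finite sums of natural numbers over enumerated sets.

Σᶠ : {I : Set} → Finite I → (I → ℕ) → ℕ
Σᶠ (_ , e) f = sum (f ∘ Inverse.from e)

size : {I : Set} → Finite I → ℕ
size = proj₁

Fin-finite : ∀ n → Finite (Fin n)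
Fin-finite n = n , ↔-id _

×-finite : {I J : Set} → Finite I → Finite J → Finite (I × J)
×-finite (m , e) (n , f) = m ℕ.* n , ↔-sym *↔× ↔-∘ (e ×-↔ f)

Σᶠ-cong : {I : Set} (fin : Finite I) {f g : I → ℕ} → (∀ i → f i ≡ g i) → Σᶠ fin f ≡ Σᶠ fin g
Σᶠ-cong fin f≗g = ∑.sum-cong-≗ (λ k → f≗g (Inverse.from (proj₂ fin) k))

sum-mono : ∀ {n} {f g : Fin n → ℕ} → (∀ i → f i ≤ g i) → sum f ≤ sum g
sum-mono {zero}  f≤g = z≤n
sum-mono {suc n} f≤g = ℕ.+-mono-≤ (f≤g zero) (sum-mono (f≤g ∘ suc))

Σᶠ-mono : {I : Set} (fin : Finite I) {f g : I → ℕ} → (∀ i → f i ≤ g i) → Σᶠ fin f ≤ Σᶠ fin g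
Σᶠ-mono fin f≤g = sum-mono (λ k → f≤g (Inverse.from (proj₂ fin) k))

Σᶠ-+ : {I : Set} (fin : Finite I) (f g : I → ℕ) →
       Σᶠ fin (λ i → f i + g i) ≡ Σᶠ fin f + Σᶠ fin g
Σᶠ-+ (_ , e) f g = ∑.∑-distrib-+ (f ∘ Inverse.from e) (g ∘ Inverse.from e)

Σᶠ-comm : {I J : Set} (finI : Finite I) (finJ : Finite J) (f : I → J → ℕ) →
          Σᶠ finI (λ i → Σᶠ finJ (f i)) ≡ Σᶠ finJ (λ j → Σᶠ finI (λ i → f i j))
Σᶠ-comm (_ , e) (_ , e′) f = ∑.∑-comm (λ k l → f (Inverse.from e k) (Inverse.from e′ l))

sum-const : ∀ n {a} → sum {n} (λ _ → a) ≡ n ℕ.* a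
sum-const zero    = refl
sum-const (suc n) {a} = cong (a +_) (sum-const n)

Σᶠ-const : {I : Set} (fin : Finite I) (a : ℕ) → Σᶠ fin (λ _ → a) ≡ size fin ℕ.* a
Σᶠ-const (n , _) a = sum-const n

sum-* : ∀ {n} a (f : Fin n → ℕ) → sum (λ i → a ℕ.* f i) ≡ a ℕ.* sum f
sum-* {zero}  a f = sym (ℕ.*-zeroʳ a)
sum-* {suc n} a f = trans (cong (a ℕ.* f zero +_) (sum-* a (f ∘ suc))) (sym (ℕ.*-distribˡ-+ a _ _))

Σᶠ-* : {I : Set} (fin : Finite I) (a : ℕ) (f : I → ℕ) → Σᶠ fin (λ i → a ℕ.* f i) ≡ a ℕ.* Σᶠ fin f
Σᶠ-* (_ , e) a f = sum-* a (f ∘ Inverse.from e)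

Σᶠ-reindex : {I J : Set} (finI : Finite I) (finJ : Finite J) (σ : J ↔ I) (f : I → ℕ) →
             Σᶠ finI f ≡ Σᶠ finJ (f ∘ Inverse.to σ)
Σᶠ-reindex (_ , e) finJ@(_ , e′) σ f = trans
  (∑.sum-permute (f ∘ Inverse.from e) (e ↔-∘ (σ ↔-∘ ↔-sym e′)))
  (Σᶠ-cong finJ (λ j → cong f (Inverse.strictlyInverseʳ e (Inverse.to σ j))))

sum-splitAt : ∀ m {n} (f : Fin (m + n) → ℕ) →
              sum f ≡ sum (λ i → f (i ↑ˡ n)) + sum (λ j → f (m ↑ʳ j))
sum-splitAt zero    f = refl
sum-splitAt (suc m) f = trans (cong (f zero +_) (sum-splitAt m (f ∘ suc))) (sym (ℕ.+-assoc (f zero) _ _))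

sum-combine : ∀ m {n} (f : Fin (m ℕ.* n) → ℕ) → sum f ≡ sum (λ i → sum (λ j → f (combine {m} i j)))
sum-combine zero        f = refl
sum-combine (suc m) {n} f = trans (sum-splitAt n f)
  (cong (sum (λ j → f (j ↑ˡ (m ℕ.* n))) +_) (sum-combine m (f ∘ (n ↑ʳ_))))

Σᶠ-× : {I J : Set} (finI : Finite I) (finJ : Finite J) (f : I × J → ℕ) →
       Σᶠ (×-finite finI finJ) f ≡ Σᶠ finI (λ i → Σᶠ finJ (λ j → f (i , j)))
Σᶠ-× finI@(m , _) finJ@(n , _) f = begin
  Σᶠ (×-finite finI finJ) f
    ≡⟨ Σᶠ-reindex (×-finite finI finJ) (m ℕ.* n , ↔-id _) (↔-sym (proj₂ (×-finite finI finJ))) f ⟩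
  sum {m ℕ.* n} (f ∘ Inverse.from (proj₂ (×-finite finI finJ)))
    ≡⟨ sum-combine m {n} (f ∘ Inverse.from (proj₂ (×-finite finI finJ))) ⟩
  sum (λ i → sum (λ j → f (Inverse.from (proj₂ (×-finite finI finJ)) (combine {m} {n} i j))))
    ≡⟨ Σᶠ-cong (Fin-finite m) (λ i → Σᶠ-cong (Fin-finite n) (λ j →
         cong (λ (a , b) → f (Inverse.from (proj₂ finI) a , Inverse.from (proj₂ finJ) b))
         (Inverse.strictlyInverseˡ (*↔× {m} {n}) (i , j)))) ⟩
  Σᶠ finI (λ i → Σᶠ finJ (λ j → f (i , j))) ∎
  where open ≡-Reasoning

+-squeeze : ∀ {a b c d} → a ≤ c → b ≤ d → c + d ≤ a + b → c ≤ a × d ≤ b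
+-squeeze {a} {b} {c} {d} a≤c b≤d p =
  ℕ.+-cancelʳ-≤ d c a (ℕ.≤-trans p (ℕ.+-monoʳ-≤ a b≤d)) ,
  ℕ.+-cancelˡ-≤ c d b (ℕ.≤-trans p (ℕ.+-monoˡ-≤ b a≤c))

sum-squeeze : ∀ {n} {f g : Fin n → ℕ} → (∀ i → f i ≤ g i) → sum g ≤ sum f → ∀ i → g i ≤ f i
sum-squeeze {suc n} f≤g p zero    = proj₁ (+-squeeze (f≤g zero) (sum-mono (f≤g ∘ suc)) p)
sum-squeeze {suc n} f≤g p (suc i) =
  sum-squeeze (f≤g ∘ suc) (proj₂ (+-squeeze (f≤g zero) (sum-mono (f≤g ∘ suc)) p)) i

-- Termwise inequalities whose totals agree leave no slack in any term. This turns one comparison of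
-- total dimensions into a comparison at every vertex.
Σᶠ-squeeze : {I : Set} (fin : Finite I) {f g : I → ℕ} → (∀ i → f i ≤ g i) →
             Σᶠ fin g ≤ Σᶠ fin f → ∀ i → g i ≤ f i
Σᶠ-squeeze (_ , e) {f} {g} f≤g p i = subst (λ j → g j ≤ f j) (Inverse.strictlyInverseʳ e i)
  (sum-squeeze (f≤g ∘ Inverse.from e) p (Inverse.to e i))

-- Permutations of the sheets as a finite set.

-- Elements of `Permutation′ n` are compared only pointwise, by `Perm.≈`. The codes carry
-- propositional equality and an enumeration, so they can serve as sheets of a `Digraph`.
Lehmer : ℕ → Set
Lehmer zero    = ⊤
Lehmer (suc n) = Fin (suc n) × Lehmer n

Lehmer-finite : ∀ n → Finite (Lehmer n)
Lehmer-finite zero    = 1 , mk↔ₛ′ (λ _ → zero) (λ _ → tt) (λ { zero → refl }) (λ _ → refl)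
Lehmer-finite (suc n) = ×-finite (Fin-finite (suc n)) (Lehmer-finite n)

decode : ∀ {n} → Lehmer n → Permutation′ n
decode {zero}  _       = Perm.id
decode {suc n} (i , p) = Perm.insert zero i (decode p)

encode : ∀ {n} → Permutation′ n → Lehmer n
encode {zero}  _ = tt
encode {suc n} π = π ⟨$⟩ʳ zero , encode (Perm.remove zero π)

insert-cong : ∀ {n} {π ρ : Permutation′ n} j → π Perm.≈ ρ →
              Perm.insert zero j π Perm.≈ Perm.insert zero j ρ
insert-cong j π≈ρ zero    = refl
insert-cong j π≈ρ (suc k) = cong (punchIn j) (π≈ρ k)

remove-cong : ∀ {n} {π ρ : Permutation′ (suc n)} → π Perm.≈ ρ →
              Perm.remove zero π Perm.≈ Perm.remove zero ρ
remove-cong {π = π} {ρ} π≈ρ k = punchIn-injective (π ⟨$⟩ʳ zero) _ _ (begin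
  punchIn (π ⟨$⟩ʳ zero) (Perm.remove zero π ⟨$⟩ʳ k) ≡⟨ Perm.punchIn-permute π zero k ⟨
  π ⟨$⟩ʳ suc k                                      ≡⟨ π≈ρ (suc k) ⟩
  ρ ⟨$⟩ʳ suc k                                      ≡⟨ Perm.punchIn-permute ρ zero k ⟩
  punchIn (ρ ⟨$⟩ʳ zero) (Perm.remove zero ρ ⟨$⟩ʳ k)
    ≡⟨ cong (λ i → punchIn i (Perm.remove zero ρ ⟨$⟩ʳ k)) (π≈ρ zero) ⟨
  punchIn (π ⟨$⟩ʳ zero) (Perm.remove zero ρ ⟨$⟩ʳ k) ∎)
  where open ≡-Reasoning

encode-cong : ∀ {n} {π ρ : Permutation′ n} → π Perm.≈ ρ → encode π ≡ encode ρ
encode-cong {zero}          π≈ρ = refl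
encode-cong {suc n} {π} {ρ} π≈ρ = cong₂ _,_ (π≈ρ zero) (encode-cong (remove-cong {π = π} {ρ} π≈ρ))

decode-encode : ∀ {n} (π : Permutation′ n) → decode (encode π) Perm.≈ π
decode-encode {suc n} π i = trans
  (insert-cong {π = decode (encode (Perm.remove zero π))} (π ⟨$⟩ʳ zero)
    (decode-encode (Perm.remove zero π)) i)
  (Perm.insert-remove zero π i)

encode-decode : ∀ {n} (p : Lehmer n) → encode (decode p) ≡ p
encode-decode {zero}  tt      = refl
encode-decode {suc n} (i , p) = cong (i ,_) (trans
  (encode-cong (Perm.remove-insert zero i (decode p))) (encode-decode p))

postcompose : ∀ {n} → Permutation′ n → Lehmer n → Lehmer n
postcompose π p = encode (decode p ∘ₚ π)

precompose : ∀ {n} → Permutation′ n → Lehmer n → Lehmer n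
precompose τ p = encode (τ ∘ₚ decode p)

decode-postcompose : ∀ {n} (π : Permutation′ n) p i →
                     decode (postcompose π p) ⟨$⟩ʳ i ≡ π ⟨$⟩ʳ (decode p ⟨$⟩ʳ i)
decode-postcompose π p i = decode-encode (decode p ∘ₚ π) i

decode-precompose : ∀ {n} (τ : Permutation′ n) p i →
                    decode (precompose τ p) ⟨$⟩ʳ i ≡ decode p ⟨$⟩ʳ (τ ⟨$⟩ʳ i)
decode-precompose τ p i = decode-encode (τ ∘ₚ decode p) i

-- Associativity of composition: acting on values and acting on arguments do not interfere. Through
-- this, translations respect tails and heads in the Galois closure.
compose-comm : ∀ {n} (π τ : Permutation′ n) p →
               postcompose π (precompose τ p) ≡ precompose τ (postcompose π p)
compose-comm π τ p = encode-cong (λ i → trans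
  (cong (π ⟨$⟩ʳ_) (decode-precompose τ p i))
  (sym (decode-postcompose π p (τ ⟨$⟩ʳ i))))

precompose-inverse : ∀ {n} (τ τ⁻¹ : Permutation′ n) → (∀ i → τ⁻¹ ⟨$⟩ʳ (τ ⟨$⟩ʳ i) ≡ i) →
                     ∀ p → precompose τ (precompose τ⁻¹ p) ≡ p
precompose-inverse τ τ⁻¹ inv p = trans
  (encode-cong (λ i → trans (decode-precompose τ⁻¹ p (τ ⟨$⟩ʳ i)) (cong (decode p ⟨$⟩ʳ_) (inv i))))
  (encode-decode p)

precompose-↔ : ∀ {n} → Permutation′ n → Lehmer n ↔ Lehmer n
precompose-↔ τ = mk↔ₛ′ (precompose τ) (precompose (Perm.flip τ))
  (precompose-inverse τ (Perm.flip τ) (λ _ → Perm.inverseˡ τ))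
  (precompose-inverse (Perm.flip τ) τ (λ _ → Perm.inverseʳ τ))

precompose-transitive : ∀ {n} (p q : Lehmer n) → ∃[ τ ] precompose τ p ≡ q
-- The permutation that applies q and then the inverse of p; applying p afterwards leaves q.
precompose-transitive p q = decode q ∘ₚ Perm.flip (decode p) , trans
  (encode-cong (λ i → Perm.inverseʳ (decode p))) (encode-decode q)

-- Minimisation, and comparison of differences without subtraction.

module _ (lem : Classical) {ℓ : Level} {X : Set ℓ} (f : X → ℕ) where

  -- Descent: a strictly smaller value fits under a bound lowered by one, so n limits the number of
  -- steps.
  minimiser-below : ∀ n x → f x ≤ n → ∃[ x ] ∀ y → f x ≤ f y
  minimiser-below n x fx≤n with lem {P = ∃[ y ] f y < f x}
  ... | no ∄y = x , λ y → ℕ.≮⇒≥ (λ fy<fx → ∄y (y , fy<fx))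
  minimiser-below zero    x fx≤n | yes (y , fy<fx) = contradiction (ℕ.<-≤-trans fy<fx fx≤n) λ ()
  minimiser-below (suc n) x fx≤n | yes (y , fy<fx) =
    minimiser-below n y (s≤s⁻¹ (ℕ.<-≤-trans fy<fx fx≤n))

  minimiser : X → ∃[ x ] ∀ y → f x ≤ f y
  minimiser x = minimiser-below (f x) x ℕ.≤-refl

⊖-mono⁻¹ : ∀ a b c d → (ℤ.+ a ℤ.- ℤ.+ b) ℤ.≤ (ℤ.+ c ℤ.- ℤ.+ d) → a + d ≤ c + b
⊖-mono⁻¹ a b c d p = ℤ.drop‿+≤+ (subst₂ ℤ._≤_ (shift a b d) shift′ (ℤ.+-monoˡ-≤ (ℤ.+ b ℤ.+ ℤ.+ d) p))
  where
  open import Data.Integer.Tactic.RingSolver using (solve-∀)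
  cancel : ∀ x y z → (x ℤ.- y) ℤ.+ (y ℤ.+ z) ≡ x ℤ.+ z
  cancel = solve-∀
  shift : ∀ a b d → (ℤ.+ a ℤ.- ℤ.+ b) ℤ.+ (ℤ.+ b ℤ.+ ℤ.+ d) ≡ ℤ.+ (a + d)
  shift a b d = cancel (ℤ.+ a) (ℤ.+ b) (ℤ.+ d)
  shift′ : (ℤ.+ c ℤ.- ℤ.+ d) ℤ.+ (ℤ.+ b ℤ.+ ℤ.+ d) ≡ ℤ.+ (c + b)
  shift′ = trans (cong (λ z → (ℤ.+ c ℤ.- ℤ.+ d) ℤ.+ z) (ℤ.+-comm (ℤ.+ b) (ℤ.+ d))) (shift c d b)

⊖-mono : ∀ a b c d → a + d ≤ c + b → (ℤ.+ a ℤ.- ℤ.+ b) ℤ.≤ (ℤ.+ c ℤ.- ℤ.+ d)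
⊖-mono a b c d p = subst₂ ℤ._≤_ (shift a b d) shift′ (ℤ.+-monoˡ-≤ (ℤ.- (ℤ.+ b ℤ.+ ℤ.+ d)) (ℤ.+≤+ p))
  where
  open import Data.Integer.Tactic.RingSolver using (solve-∀)
  cancel : ∀ x y z → (x ℤ.+ z) ℤ.- (y ℤ.+ z) ≡ x ℤ.- y
  cancel = solve-∀
  shift : ∀ a b d → ℤ.+ (a + d) ℤ.- (ℤ.+ b ℤ.+ ℤ.+ d) ≡ ℤ.+ a ℤ.- ℤ.+ b
  shift a b d = cancel (ℤ.+ a) (ℤ.+ b) (ℤ.+ d)
  shift′ : ℤ.+ (c + b) ℤ.- (ℤ.+ b ℤ.+ ℤ.+ d) ≡ ℤ.+ c ℤ.- ℤ.+ d
  shift′ = trans (cong (λ z → ℤ.+ (c + b) ℤ.- z) (ℤ.+-comm (ℤ.+ b) (ℤ.+ d))) (shift c d b)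

-- Since n bounds both a and c, the truncated differences are exact, and a smaller defect
-- `(n ∸ a) + b` means a larger a - b.
defect-≤ : ∀ n {a b c d} → a ≤ n → c ≤ n → (n ∸ a) + b ≤ (n ∸ c) + d → c + b ≤ a + d
defect-≤ n {a} {b} {c} {d} a≤n c≤n p = ℕ.+-cancelˡ-≤ n _ _ (begin
  n + (c + b)                 ≡⟨ cong (_+ (c + b)) (ℕ.m∸n+n≡m a≤n) ⟨
  ((n ∸ a) + a) + (c + b)     ≡⟨ shuffle (n ∸ a) a c b ⟩
  ((n ∸ a) + b) + (a + c)     ≤⟨ ℕ.+-monoˡ-≤ (a + c) p ⟩
  ((n ∸ c) + d) + (a + c)     ≡⟨ shuffle′ (n ∸ c) a c d ⟩
  ((n ∸ c) + c) + (a + d)     ≡⟨ cong (_+ (a + d)) (ℕ.m∸n+n≡m c≤n) ⟩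
  n + (a + d)                 ∎)
  where
  open ℕ.≤-Reasoning
  open import Data.Nat.Tactic.RingSolver using (solve-∀)
  shuffle : ∀ x a c b → (x + a) + (c + b) ≡ (x + b) + (a + c)
  shuffle = solve-∀
  shuffle′ : ∀ x a c d → (x + d) + (a + c) ≡ (x + c) + (a + d)
  shuffle′ = solve-∀

-- The uncrossing argument: S and I are the sum and intersection of L and B, and C is a competitor.
-- Together S and I have at least the excess of L and B; as I has at most that of L, S has at least
-- that of B, hence at least that of C.
uncross : ∀ eL vL eB vB eS vS eI vI eC vC →
          eL + eB ≤ eS + eI → vL + vB ≡ vS + vI →
          eI + vL ≤ eL + vI → eC + vB ≤ eB + vC → eC + vS ≤ eS + vC
uncross eL vL eB vB eS vS eI vI eC vC super modular I≼L C≼B = ℕ.+-cancelʳ-≤ (eI + vI) _ _ (begin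
  (eC + vS) + (eI + vI) ≡⟨ s₁ eC vS eI vI ⟩
  (eI + eC) + (vS + vI) ≡⟨ cong ((eI + eC) +_) modular ⟨
  (eI + eC) + (vL + vB) ≡⟨ s₂ eI eC vL vB ⟩
  (eI + vL) + (eC + vB) ≤⟨ ℕ.+-mono-≤ I≼L C≼B ⟩
  (eL + vI) + (eB + vC) ≡⟨ s₂ eL vI eB vC ⟩
  (eL + eB) + (vI + vC) ≤⟨ ℕ.+-monoˡ-≤ (vI + vC) super ⟩
  (eS + eI) + (vI + vC) ≡⟨ s₃ eS eI vI vC ⟩
  (eS + vC) + (eI + vI) ∎)
  where
  open ℕ.≤-Reasoning
  open import Data.Nat.Tactic.RingSolver using (solve-∀)
  s₁ : ∀ a b c d → (a + b) + (c + d) ≡ (c + a) + (b + d)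
  s₁ = solve-∀
  s₂ : ∀ a b c d → (a + b) + (c + d) ≡ (a + c) + (b + d)
  s₂ = solve-∀
  s₃ : ∀ a b c d → (a + b) + (c + d) ≡ (a + d) + (b + c)
  s₃ = solve-∀

-- Linear algebra over a field.

module LinearAlgebra (lem : Classical) {ℓ : Level} (𝔽 : HeytingField ℓ ℓ ℓ) where

  open HeytingField 𝔽 public using (0#; 1#)
    renaming (Carrier to Scalar; _≈_ to _≈ˢ_; _*_ to _*ˢ_; _+_ to _+ˢ_; -_ to -ˢ_)
  private module K = HeytingField 𝔽

  V𝕊 : Set (Level.suc ℓ)
  V𝕊 = VectorSpace 𝔽

  -- Excluded middle and tightness give `a # 0#`. The Heyting field then inverts the difference a -
  -- 0, whence the correction `a≈a-0`.
  invertible : ∀ {a} → ¬ a ≈ˢ 0# → ∃[ b ] b *ˢ a ≈ˢ 1#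
  invertible {a} a≉0 with lem {P = K._#_ a 0#}
  ... | no ¬a#0 = contradiction (proj₁ (K.tight a 0#) ¬a#0) a≉0
  ... | yes a#0 with K.#⇒invertible a#0
  ...   | b , b*a , _ = b , K.trans (K.*-cong K.refl a≈a-0) b*a
    where
    a≈a-0 : a ≈ˢ (a +ˢ (-ˢ 0#))
    a≈a-0 = K.sym (K.trans (K.+-cong K.refl
      (K.trans (K.sym (K.+-identityˡ _)) (K.-‿inverseʳ 0#))) (K.+-identityʳ a))

  1≉0 : ¬ 1# ≈ˢ 0#
  1≉0 1≈0 = K.#-irrefl K.refl (K.invertible⇒# {0#} {0#}
    (0# , collapse _ _ , collapse _ _))
    where
    collapse : ∀ x y → x ≈ˢ y
    collapse x y = K.trans (x≈0 x) (K.sym (x≈0 y))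
      where
      x≈0 : ∀ x → x ≈ˢ 0#
      x≈0 x = K.trans (K.sym (K.*-identityʳ x)) (K.trans (K.*-cong K.refl 1≈0) (K.zeroʳ x))

  infix 4 _∈_ _⊑_

  _∈_ : {M : V𝕊} → LeftModule.Carrierᴹ M → Subspace 𝔽 M → Set ℓ
  x ∈ U = Subspace.Contains U x

  _⊑_ : {M : V𝕊} → Subspace 𝔽 M → Subspace 𝔽 M → Set ℓ
  U ⊑ W = ∀ {x} → x ∈ U → x ∈ W

  ⟦_⟧ : {M N : V𝕊} → LinearMap 𝔽 M N → LeftModule.Carrierᴹ M → LeftModule.Carrierᴹ N
  ⟦ f ⟧ = LinearMap.⟦_⟧ f

  module _ {M : V𝕊} where
    open LeftModule M
    open SetoidReasoning ≈ᴹ-setoid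

    𝟎 : Subspace 𝔽 M
    𝟎 = record
      { Contains = _≈ᴹ 0ᴹ
      ; ∈-resp-≈ = λ x≈y x≈0 → ≈ᴹ-trans (≈ᴹ-sym x≈y) x≈0
      ; 0ᴹ-∈     = ≈ᴹ-refl
      ; +ᴹ-∈     = λ p q → ≈ᴹ-trans (+ᴹ-cong p q) (+ᴹ-identityˡ 0ᴹ)
      ; *ₗ-∈     = λ a p → ≈ᴹ-trans (*ₗ-congˡ p) (*ₗ-zeroʳ a)
      }

    line : Carrierᴹ → Subspace 𝔽 M
    line b = record
      { Contains = λ x → ∃[ a ] x ≈ᴹ a *ₗ b
      ; ∈-resp-≈ = λ x≈y (a , p) → a , ≈ᴹ-trans (≈ᴹ-sym x≈y) p
      ; 0ᴹ-∈     = 0# , ≈ᴹ-sym (*ₗ-zeroˡ b)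
      ; +ᴹ-∈     = λ (a , p) (a′ , p′) → a +ˢ a′ ,
                     ≈ᴹ-trans (+ᴹ-cong p p′) (≈ᴹ-sym (*ₗ-distribʳ b a a′))
      ; *ₗ-∈     = λ c (a , p) → c *ˢ a , ≈ᴹ-trans (*ₗ-congˡ p) (≈ᴹ-sym (*ₗ-assoc c a b))
      }

    interchange : ∀ u w u′ w′ → ((u +ᴹ w) +ᴹ (u′ +ᴹ w′)) ≈ᴹ ((u +ᴹ u′) +ᴹ (w +ᴹ w′))
    interchange u w u′ w′ = begin
      (u +ᴹ w) +ᴹ (u′ +ᴹ w′) ≈⟨ +ᴹ-assoc u w (u′ +ᴹ w′) ⟩
      u +ᴹ (w +ᴹ (u′ +ᴹ w′)) ≈⟨ +ᴹ-congˡ (+ᴹ-assoc w u′ w′) ⟨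
      u +ᴹ ((w +ᴹ u′) +ᴹ w′) ≈⟨ +ᴹ-congˡ (+ᴹ-congʳ (+ᴹ-comm w u′)) ⟩
      u +ᴹ ((u′ +ᴹ w) +ᴹ w′) ≈⟨ +ᴹ-congˡ (+ᴹ-assoc u′ w w′) ⟩
      u +ᴹ (u′ +ᴹ (w +ᴹ w′)) ≈⟨ +ᴹ-assoc u u′ (w +ᴹ w′) ⟨
      (u +ᴹ u′) +ᴹ (w +ᴹ w′) ∎

    infixl 6 _⊞_

    _⊞_ : Subspace 𝔽 M → Subspace 𝔽 M → Subspace 𝔽 M
    U ⊞ W = record
      { Contains = λ x → ∃[ u ] ∃[ w ] u ∈ U × w ∈ W × x ≈ᴹ u +ᴹ w
      ; ∈-resp-≈ = λ { x≈y (u , w , p , q , e) → u , w , p , q , ≈ᴹ-trans (≈ᴹ-sym x≈y) e }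
      ; 0ᴹ-∈     = 0ᴹ , 0ᴹ , U.0ᴹ-∈ , W.0ᴹ-∈ , ≈ᴹ-sym (+ᴹ-identityˡ 0ᴹ)
      ; +ᴹ-∈     = λ { (u , w , p , q , e) (u′ , w′ , p′ , q′ , e′) →
                     u +ᴹ u′ , w +ᴹ w′ , U.+ᴹ-∈ p p′ , W.+ᴹ-∈ q q′ ,
                     ≈ᴹ-trans (+ᴹ-cong e e′) (interchange u w u′ w′) }
      ; *ₗ-∈     = λ { a (u , w , p , q , e) → a *ₗ u , a *ₗ w , U.*ₗ-∈ a p , W.*ₗ-∈ a q ,
                     ≈ᴹ-trans (*ₗ-congˡ e) (*ₗ-distribˡ a u w) }
      }
      where
      module U = Subspace U
      module W = Subspace W

    ⊞-⊒ˡ : (U W : Subspace 𝔽 M) → U ⊑ U ⊞ W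
    ⊞-⊒ˡ U W {x} p = x , 0ᴹ , p , Subspace.0ᴹ-∈ W , ≈ᴹ-sym (+ᴹ-identityʳ x)

    ⊞-⊒ʳ : (U W : Subspace 𝔽 M) → W ⊑ U ⊞ W
    ⊞-⊒ʳ U W {x} p = 0ᴹ , x , Subspace.0ᴹ-∈ U , p , ≈ᴹ-sym (+ᴹ-identityˡ x)

    ⊞-least : (U W T : Subspace 𝔽 M) → U ⊑ T → W ⊑ T → U ⊞ W ⊑ T
    ⊞-least U W T U⊑T W⊑T (u , w , p , q , e) =
      Subspace.∈-resp-≈ T (≈ᴹ-sym e) (Subspace.+ᴹ-∈ T (U⊑T p) (W⊑T q))

    𝟎-⊑ : (U : Subspace 𝔽 M) → 𝟎 ⊑ U
    𝟎-⊑ U x≈0 = Subspace.∈-resp-≈ U (≈ᴹ-sym x≈0) (Subspace.0ᴹ-∈ U)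

    adjoin : Subspace 𝔽 M → Carrierᴹ → Subspace 𝔽 M
    adjoin U b = U ⊞ line b

    adjoin-⊒ : (U : Subspace 𝔽 M) (b : Carrierᴹ) → U ⊑ adjoin U b
    adjoin-⊒ U b = ⊞-⊒ˡ U (line b)

    ∈-adjoin : (U : Subspace 𝔽 M) (b : Carrierᴹ) → b ∈ adjoin U b
    ∈-adjoin U b = ⊞-⊒ʳ U (line b) (1# , ≈ᴹ-sym (*ₗ-identityˡ b))

    adjoin-least : (U T : Subspace 𝔽 M) {b : Carrierᴹ} → U ⊑ T → b ∈ T → adjoin U b ⊑ T
    adjoin-least U T {b} U⊑T b∈T = ⊞-least U (line b) T U⊑T
      (λ (a , e) → Subspace.∈-resp-≈ T (≈ᴹ-sym e) (Subspace.*ₗ-∈ T a b∈T))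

    adjoin-mono : (U U′ : Subspace 𝔽 M) (b : Carrierᴹ) → U ⊑ U′ → adjoin U b ⊑ adjoin U′ b
    adjoin-mono U U′ b U⊑U′ =
      adjoin-least U (adjoin U′ b) (adjoin-⊒ U′ b ∘ U⊑U′) (∈-adjoin U′ b)

    adjoin-swap : (U : Subspace 𝔽 M) (b c : Carrierᴹ) → adjoin (adjoin U b) c ⊑ adjoin (adjoin U c) b
    adjoin-swap U b c = adjoin-least (adjoin U b) T
      (adjoin-mono U (adjoin U c) b (adjoin-⊒ U c))
      (adjoin-⊒ (adjoin U c) b (∈-adjoin U c))
      where T = adjoin (adjoin U c) b

    -*ₗ-inverse : ∀ a x → (a *ₗ x) +ᴹ ((-ˢ a) *ₗ x) ≈ᴹ 0ᴹ
    -*ₗ-inverse a x = begin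
      (a *ₗ x) +ᴹ ((-ˢ a) *ₗ x) ≈⟨ *ₗ-distribʳ x a (-ˢ a) ⟨
      (a +ˢ (-ˢ a)) *ₗ x        ≈⟨ *ₗ-congʳ (K.-‿inverseʳ a) ⟩
      0# *ₗ x                   ≈⟨ *ₗ-zeroˡ x ⟩
      0ᴹ                        ∎

    +-*ₗ-cancel : ∀ y a x → (y +ᴹ (a *ₗ x)) +ᴹ ((-ˢ a) *ₗ x) ≈ᴹ y
    +-*ₗ-cancel y a x = begin
      (y +ᴹ (a *ₗ x)) +ᴹ ((-ˢ a) *ₗ x) ≈⟨ +ᴹ-assoc y (a *ₗ x) _ ⟩
      y +ᴹ ((a *ₗ x) +ᴹ ((-ˢ a) *ₗ x)) ≈⟨ +ᴹ-congˡ (-*ₗ-inverse a x) ⟩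
      y +ᴹ 0ᴹ                          ≈⟨ +ᴹ-identityʳ y ⟩
      y                                ∎

    -*ₗ-cancel : ∀ y a x → (y +ᴹ ((-ˢ a) *ₗ x)) +ᴹ (a *ₗ x) ≈ᴹ y
    -*ₗ-cancel y a x = begin
      (y +ᴹ ((-ˢ a) *ₗ x)) +ᴹ (a *ₗ x) ≈⟨ +ᴹ-assoc y ((-ˢ a) *ₗ x) _ ⟩
      y +ᴹ (((-ˢ a) *ₗ x) +ᴹ (a *ₗ x)) ≈⟨ +ᴹ-congˡ (+ᴹ-comm _ _) ⟩
      y +ᴹ ((a *ₗ x) +ᴹ ((-ˢ a) *ₗ x)) ≈⟨ +ᴹ-congˡ (-*ₗ-inverse a x) ⟩
      y +ᴹ 0ᴹ                          ≈⟨ +ᴹ-identityʳ y ⟩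
      y                                ∎

    ∈-cancelʳ : (T : Subspace 𝔽 M) {x y : Carrierᴹ} → y ∈ T → (x +ᴹ y) ∈ T → x ∈ T
    ∈-cancelʳ T {x} {y} y∈T x+y∈T = T.∈-resp-≈
      (≈ᴹ-trans (+ᴹ-congʳ (+ᴹ-congˡ (≈ᴹ-sym (*ₗ-identityˡ y)))) (+-*ₗ-cancel x 1# y))
      (T.+ᴹ-∈ x+y∈T (T.*ₗ-∈ (-ˢ 1#) y∈T))
      where module T = Subspace T

    ∈-unscale : (T : Subspace 𝔽 M) {a : Scalar} {x : Carrierᴹ} → ¬ a ≈ˢ 0# → (a *ₗ x) ∈ T → x ∈ T
    ∈-unscale T {a} {x} a≉0 ax∈T with invertible a≉0
    ... | b , ba≈1 = T.∈-resp-≈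
      (≈ᴹ-trans (≈ᴹ-sym (*ₗ-assoc b a x)) (≈ᴹ-trans (*ₗ-congʳ ba≈1) (*ₗ-identityˡ x)))
      (T.*ₗ-∈ b ax∈T)
      where module T = Subspace T

    -- In c = u + a b the coefficient a is nonzero, as otherwise c would lie in U; dividing by a
    -- expresses b through u and c.
    adjoin-exchange : (U : Subspace 𝔽 M) {b c : Carrierᴹ} →
                      c ∈ adjoin U b → ¬ c ∈ U → b ∈ adjoin U c
    adjoin-exchange U {b} {c} (u , w , u∈U , (a , w≈ab) , c≈u+w) c∉U =
      ∈-unscale T a≉0 (T.∈-resp-≈ w≈ab (∈-cancelʳ T (adjoin-⊒ U c u∈U)
        (T.∈-resp-≈ (≈ᴹ-trans c≈u+w (+ᴹ-comm u w)) (∈-adjoin U c))))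
      where
      T = adjoin U c
      module T = Subspace T
      module U = Subspace U
      a≉0 : ¬ a ≈ˢ 0#
      a≉0 a≈0 = c∉U (U.∈-resp-≈ (≈ᴹ-sym (begin
        c              ≈⟨ c≈u+w ⟩
        u +ᴹ w         ≈⟨ +ᴹ-congˡ w≈ab ⟩
        u +ᴹ (a *ₗ b)  ≈⟨ +ᴹ-congˡ (*ₗ-congʳ a≈0) ⟩
        u +ᴹ (0# *ₗ b) ≈⟨ +ᴹ-congˡ (*ₗ-zeroˡ b) ⟩
        u +ᴹ 0ᴹ        ≈⟨ +ᴹ-identityʳ u ⟩
        u              ∎)) u∈U)

    -- Relative dimension by flags.

    -- An upper bound k for the dimension of W modulo U. The vectors may be redundant and may lie
    -- outside W, which lets the bound pass to smaller W and larger U.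
    Spanned : Subspace 𝔽 M → Subspace 𝔽 M → ℕ → Set ℓ
    Spanned U W zero    = W ⊑ U
    Spanned U W (suc k) = ∃[ b ] Spanned (adjoin U b) W k

    -- For U ⊑ W, Flag U W k says that W / U has dimension k.
    Flag : Subspace 𝔽 M → Subspace 𝔽 M → ℕ → Set ℓ
    Flag U W zero    = W ⊑ U
    Flag U W (suc k) = ∃[ b ] b ∈ W × ¬ b ∈ U × Flag (adjoin U b) W k

    spanned-mono : ∀ {U U′ W W′} k → U ⊑ U′ → W′ ⊑ W → Spanned U W k → Spanned U′ W′ k
    spanned-mono zero    U⊑U′ W′⊑W W⊑U = U⊑U′ ∘ W⊑U ∘ W′⊑W
    spanned-mono {U} {U′} {W} {W′} (suc k) U⊑U′ W′⊑W (b , s) =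
      b , spanned-mono {adjoin U b} {adjoin U′ b} {W} {W′} k (adjoin-mono U U′ b U⊑U′) W′⊑W s

    -- Steinitz exchange: c replaces the first spanning vector b for which c lies in the span so
    -- far. Until then b is absorbed into U, and the two adjunctions are swapped back afterwards.
    spanned-exchange : ∀ {U W c} k → c ∈ W → ¬ c ∈ U → Spanned U W (suc k) → Spanned (adjoin U c) W k
    spanned-exchange {U} {W} {c} k c∈W c∉U (b , s) with lem {P = c ∈ adjoin U b}
    ... | yes c∈U+b = spanned-mono {adjoin U b} {adjoin U c} {W} {W} k
      (adjoin-least U (adjoin U c) (adjoin-⊒ U c) (adjoin-exchange U c∈U+b c∉U)) id s
    spanned-exchange zero c∈W c∉U (b , s) | no c∉U+b = contradiction (s c∈W) c∉U+b
    spanned-exchange {U} {W} {c} (suc k) c∈W c∉U (b , s) | no c∉U+b =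
      b , spanned-mono {adjoin (adjoin U b) c} {adjoin (adjoin U c) b} {W} {W} k
            (adjoin-swap U b c) id (spanned-exchange {adjoin U b} {W} k c∈W c∉U+b s)

    -- Each vector of the flag uses up one spanning vector by exchange.
    flag≤spanned : ∀ {U W} l k → Flag U W l → Spanned U W k → l ≤ k
    flag≤spanned zero    k       _                   _ = z≤n
    flag≤spanned (suc l) zero    (c , c∈W , c∉U , _) s = contradiction (s c∈W) c∉U
    flag≤spanned {U} {W} (suc l) (suc k) (c , c∈W , c∉U , f) s =
      s≤s (flag≤spanned {adjoin U c} {W} l k f (spanned-exchange {U} {W} k c∈W c∉U s))

    flag⇒spanned : ∀ {U W} k → Flag U W k → Spanned U W k
    flag⇒spanned zero    f               = f
    flag⇒spanned {U} {W} (suc k) (b , _ , _ , f) = b , flag⇒spanned {adjoin U b} {W} k f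

    flag-mono : ∀ {U W W′ k l} → W ⊑ W′ → Flag U W k → Flag U W′ l → k ≤ l
    flag-mono {U} {W} {W′} {k} {l} W⊑W′ f g =
      flag≤spanned {U} {W} k l f (spanned-mono {U} {U} {W′} {W} l id W⊑W′ (flag⇒spanned {U} {W′} l g))

    flag-unique : ∀ {U W k l} → Flag U W k → Flag U W l → k ≡ l
    flag-unique {U} {W} f g =
      ℕ.≤-antisym (flag-mono {U} {W} {W} id f g) (flag-mono {U} {W} {W} id g f)

    -- Vectors outside the current subspace are added greedily. Each one lowers the spanning bound,
    -- so the process stops, with excluded middle deciding when.
    flag-exists : ∀ {U W} n → Spanned U W n → ∃[ k ] Flag U W k
    flag-exists zero s = 0 , s
    flag-exists {U} {W} (suc n) s with lem {P = ∃[ c ] c ∈ W × ¬ c ∈ U}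
    ... | yes (c , c∈W , c∉U) with flag-exists {adjoin U c} {W} n (spanned-exchange {U} {W} n c∈W c∉U s)
    ...   | k , f = suc k , c , c∈W , c∉U , f
    flag-exists {U} {W} (suc n) s | no ∄c =
      0 , λ {x} x∈W → decidable-stable lem (λ x∉U → ∄c (x , x∈W , x∉U))

    flag-resp : ∀ {U U′ W W′} k → U ⊑ U′ → U′ ⊑ U → W ⊑ W′ → W′ ⊑ W → Flag U W k → Flag U′ W′ k
    flag-resp zero    U⊑U′ _ _ W′⊑W W⊑U = U⊑U′ ∘ W⊑U ∘ W′⊑W
    flag-resp {U} {U′} {W} {W′} (suc k) U⊑U′ U′⊑U W⊑W′ W′⊑W (b , b∈W , b∉U , f) =
      b , W⊑W′ b∈W , b∉U ∘ U′⊑U ,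
      flag-resp {adjoin U b} {adjoin U′ b} {W} {W′} k
        (adjoin-mono U U′ b U⊑U′) (adjoin-mono U′ U b U′⊑U) W⊑W′ W′⊑W f

    -- The source of additivity of dimension, and so of the modular law and the dimension of a
    -- direct sum.
    flag-trans : ∀ {U V W} k l → U ⊑ V → V ⊑ W → Flag U V k → Flag V W l → Flag U W (k + l)
    flag-trans {U} {V} {W} zero l U⊑V V⊑W V⊑U g = flag-resp {V} {U} {W} {W} l V⊑U U⊑V id id g
    flag-trans {U} {V} {W} (suc k) l U⊑V V⊑W (b , b∈V , b∉U , f) g =
      b , V⊑W b∈V , b∉U ,
      flag-trans {adjoin U b} {V} {W} k l (adjoin-least U V U⊑V b∈V) V⊑W f g

    -- A basis of W modulo U. Induction along a flag enlarges U, so the absolute notion `IsBasis`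
    -- would not be general enough.
    record IsRelativeBasis (U W : Subspace 𝔽 M) {k : ℕ} (b : Fin k → Carrierᴹ) : Set ℓ where
      field
        inside      : ∀ i → b i ∈ W
        independent : ∀ c → linComb 𝔽 M c b ∈ U → ∀ i → c i ≈ˢ 0#
        spanning    : ∀ x → x ∈ W → ∃[ c ] ∃[ u ] u ∈ U × x ≈ᴹ u +ᴹ linComb 𝔽 M c b

    linComb-zero : ∀ {k} {c : Fin k → Scalar} (b : Fin k → Carrierᴹ) →
                   (∀ i → c i ≈ˢ 0#) → linComb 𝔽 M c b ≈ᴹ 0ᴹ
    linComb-zero {zero}  b c≈0 = ≈ᴹ-refl
    linComb-zero {suc k} b c≈0 = ≈ᴹ-trans
      (+ᴹ-cong (≈ᴹ-trans (*ₗ-congʳ (c≈0 zero)) (*ₗ-zeroˡ (b zero)))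
               (linComb-zero (b ∘ suc) (c≈0 ∘ suc)))
      (+ᴹ-identityˡ 0ᴹ)

    flag⇒relativeBasis : ∀ {U W} k → Flag U W k → ∃[ b ] IsRelativeBasis U W {k} b
    flag⇒relativeBasis zero W⊑U = (λ ()) , record
      { inside      = λ ()
      ; independent = λ _ _ ()
      ; spanning    = λ x x∈W → (λ ()) , x , W⊑U x∈W , ≈ᴹ-sym (+ᴹ-identityʳ x)
      }
    flag⇒relativeBasis {U} {W} (suc k) (b₀ , b₀∈W , b₀∉U , f)
      with flag⇒relativeBasis {adjoin U b₀} {W} k f
    ... | b , isBasis = b₀ ∷ᶠ b , record
      { inside      = λ { zero → b₀∈W ; (suc i) → B.inside i }
      ; independent = independent
      ; spanning    = spanning
      }
      where
      module B = IsRelativeBasis isBasis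
      module U = Subspace U
      module U+b₀ = Subspace (adjoin U b₀)

      independent : ∀ c → linComb 𝔽 M c (b₀ ∷ᶠ b) ∈ U → ∀ i → c i ≈ˢ 0#
      independent c c∈U = λ { zero → c₀≈0 ; (suc i) → c₊≈0 i }
        where
        -- Modulo the line of b₀ the relation involves only the later vectors, so their coefficients
        -- vanish. What remains is a multiple of b₀ in U, and b₀ is outside U.
        c₊≈0 : ∀ i → c (suc i) ≈ˢ 0#
        c₊≈0 = B.independent (c ∘ suc) (∈-cancelʳ (adjoin U b₀)
          (U+b₀.*ₗ-∈ (c zero) (∈-adjoin U b₀))
          (U+b₀.∈-resp-≈ (+ᴹ-comm _ _) (adjoin-⊒ U b₀ c∈U)))
        c₀≈0 : c zero ≈ˢ 0#
        c₀≈0 = decidable-stable lem (λ c₀≉0 → b₀∉U (∈-unscale U c₀≉0 (U.∈-resp-≈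
          (≈ᴹ-trans (+ᴹ-congˡ (linComb-zero b c₊≈0)) (+ᴹ-identityʳ _)) c∈U)))

      spanning : ∀ x → x ∈ W → ∃[ c ] ∃[ u ] u ∈ U × x ≈ᴹ u +ᴹ linComb 𝔽 M c (b₀ ∷ᶠ b)
      spanning x x∈W with B.spanning x x∈W
      ... | c , y , (u , w , u∈U , (a , w≈ab₀) , y≈u+w) , x≈y+lc = a ∷ᶠ c , u , u∈U , (begin
        x                                         ≈⟨ x≈y+lc ⟩
        y +ᴹ linComb 𝔽 M c b                      ≈⟨ +ᴹ-congʳ (≈ᴹ-trans y≈u+w (+ᴹ-congˡ w≈ab₀)) ⟩
        (u +ᴹ (a *ₗ b₀)) +ᴹ linComb 𝔽 M c b       ≈⟨ +ᴹ-assoc _ _ _ ⟩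
        u +ᴹ ((a *ₗ b₀) +ᴹ linComb 𝔽 M c b)       ∎)

    relativeBasis⇒flag : ∀ {U W} k (b : Fin k → Carrierᴹ) → IsRelativeBasis U W b → Flag U W k
    relativeBasis⇒flag {U} {W} zero b isBasis {x} x∈W with IsRelativeBasis.spanning isBasis x x∈W
    ... | c , u , u∈U , x≈u+0 = Subspace.∈-resp-≈ U (≈ᴹ-sym (≈ᴹ-trans x≈u+0 (+ᴹ-identityʳ u))) u∈U
    relativeBasis⇒flag {U} {W} (suc k) b isBasis =
      b zero , B.inside zero , b₀∉U , relativeBasis⇒flag {adjoin U (b zero)} {W} k (b ∘ suc) (record
        { inside      = B.inside ∘ suc
        ; independent = independent
        ; spanning    = spanning
        })
      where
      module B = IsRelativeBasis isBasis
      module U = Subspace U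

      b₀∉U : ¬ b zero ∈ U
      -- The coefficients (1, 0, ..., 0) would be a relation modulo U.
      b₀∉U b₀∈U = 1≉0 (B.independent (1# ∷ᶠ (λ _ → 0#)) (U.∈-resp-≈ (≈ᴹ-sym (begin
        (1# *ₗ b zero) +ᴹ linComb 𝔽 M (λ _ → 0#) (b ∘ suc)
          ≈⟨ +ᴹ-cong (*ₗ-identityˡ (b zero)) (linComb-zero (b ∘ suc) (λ _ → K.refl)) ⟩
        b zero +ᴹ 0ᴹ ≈⟨ +ᴹ-identityʳ (b zero) ⟩
        b zero       ∎)) b₀∈U) zero)

      independent : ∀ c → linComb 𝔽 M c (b ∘ suc) ∈ adjoin U (b zero) → ∀ i → c i ≈ˢ 0#
      independent c (u , w , u∈U , (a , w≈ab₀) , lc≈u+w) i =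
        B.independent ((-ˢ a) ∷ᶠ c) (U.∈-resp-≈ (≈ᴹ-sym (begin
          ((-ˢ a) *ₗ b zero) +ᴹ linComb 𝔽 M c (b ∘ suc) ≈⟨ +ᴹ-comm _ _ ⟩
          linComb 𝔽 M c (b ∘ suc) +ᴹ ((-ˢ a) *ₗ b zero)
            ≈⟨ +ᴹ-congʳ (≈ᴹ-trans lc≈u+w (+ᴹ-congˡ w≈ab₀)) ⟩
          (u +ᴹ (a *ₗ b zero)) +ᴹ ((-ˢ a) *ₗ b zero) ≈⟨ +-*ₗ-cancel u a (b zero) ⟩
          u ∎)) u∈U) (suc i)

      spanning : ∀ x → x ∈ W →
                 ∃[ c ] ∃[ u ] u ∈ adjoin U (b zero) × x ≈ᴹ u +ᴹ linComb 𝔽 M c (b ∘ suc)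
      spanning x x∈W with B.spanning x x∈W
      ... | c , u , u∈U , x≈ = c ∘ suc , u +ᴹ (c zero *ₗ b zero) ,
        (u , c zero *ₗ b zero , u∈U , (c zero , ≈ᴹ-refl) , ≈ᴹ-refl) ,
        ≈ᴹ-trans x≈ (≈ᴹ-sym (+ᴹ-assoc _ _ _))

    flag⇒hasDim : ∀ {U k} → Flag 𝟎 U k → HasDim 𝔽 U k
    flag⇒hasDim {U} {k} f with flag⇒relativeBasis {𝟎} {U} k f
    ... | b , isBasis = b , record
      { inside      = B.inside
      ; independent = B.independent
      ; spanning    = λ x x∈U → let c , u , u≈0 , x≈ = B.spanning x x∈U in
          c , ≈ᴹ-trans x≈ (≈ᴹ-trans (+ᴹ-congʳ u≈0) (+ᴹ-identityˡ _))
      }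
      where module B = IsRelativeBasis isBasis

    hasDim⇒flag : ∀ {U k} → HasDim 𝔽 U k → Flag 𝟎 U k
    hasDim⇒flag {U} {k} (b , isBasis) = relativeBasis⇒flag {𝟎} {U} k b (record
      { inside      = B.inside
      ; independent = B.independent
      ; spanning    = λ x x∈U → let c , x≈ = B.spanning x x∈U in
          c , 0ᴹ , ≈ᴹ-refl , ≈ᴹ-trans x≈ (≈ᴹ-sym (+ᴹ-identityˡ _))
      })
      where module B = IsBasis isBasis

  module _ {M N : V𝕊} (f : LinearMap 𝔽 M N) where
    private
      module M = LeftModule M
      module N = LeftModule N
      module f = LinearMap f
    open SetoidReasoning N.≈ᴹ-setoid

    -- The isomorphism A / U ≅ T / V induced by f.
    flag-map : ∀ {U A : Subspace 𝔽 M} {V T : Subspace 𝔽 N} k →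
               (∀ {x} → x ∈ A → ⟦ f ⟧ x ∈ V → x ∈ U) →
               (∀ {x} → x ∈ U → ⟦ f ⟧ x ∈ V) →
               (∀ {x} → x ∈ A → ⟦ f ⟧ x ∈ T) →
               (∀ {y} → y ∈ T → ∃[ v ] ∃[ x ] v ∈ V × x ∈ A × N._≈ᴹ_ y (v N.+ᴹ ⟦ f ⟧ x)) →
               Flag U A k → Flag V T k
    flag-map {U} {A} {V} {T} zero inj fU⊑V fA⊑T surj A⊑U y∈T with surj y∈T
    ... | v , x , v∈V , x∈A , y≈ =
      Subspace.∈-resp-≈ V (N.≈ᴹ-sym y≈) (Subspace.+ᴹ-∈ V v∈V (fU⊑V (A⊑U x∈A)))
    flag-map {U} {A} {V} {T} (suc k) inj fU⊑V fA⊑T surj (b , b∈A , b∉U , g) =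
      ⟦ f ⟧ b , fA⊑T b∈A , b∉U ∘ inj b∈A ,
      flag-map {adjoin U b} {A} {adjoin V (⟦ f ⟧ b)} {T} k inj′ fU′⊑V′ fA⊑T
        (λ y∈T → let v , x , v∈V , p = surj y∈T in v , x , adjoin-⊒ V (⟦ f ⟧ b) v∈V , p) g
      where
      module A = Subspace A
      module V = Subspace V

      inj′ : ∀ {x} → x ∈ A → ⟦ f ⟧ x ∈ adjoin V (⟦ f ⟧ b) → x ∈ adjoin U b
      inj′ {x} x∈A (v , w , v∈V , (a , w≈) , fx≈) =
        x M.+ᴹ ((-ˢ a) M.*ₗ b) , a M.*ₗ b ,
        inj (A.+ᴹ-∈ x∈A (A.*ₗ-∈ (-ˢ a) b∈A)) (V.∈-resp-≈ (N.≈ᴹ-sym (begin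
          ⟦ f ⟧ (x M.+ᴹ ((-ˢ a) M.*ₗ b))              ≈⟨ f.+ᴹ-homo x _ ⟩
          ⟦ f ⟧ x N.+ᴹ ⟦ f ⟧ ((-ˢ a) M.*ₗ b)
            ≈⟨ N.+ᴹ-cong (N.≈ᴹ-trans fx≈ (N.+ᴹ-congˡ w≈)) (f.*ₗ-homo (-ˢ a) b) ⟩
          (v N.+ᴹ (a N.*ₗ ⟦ f ⟧ b)) N.+ᴹ ((-ˢ a) N.*ₗ ⟦ f ⟧ b) ≈⟨ +-*ₗ-cancel {N} v a (⟦ f ⟧ b) ⟩
          v ∎)) v∈V) ,
        (a , M.≈ᴹ-refl) , M.≈ᴹ-sym (-*ₗ-cancel {M} x a b)

      fU′⊑V′ : ∀ {x} → x ∈ adjoin U b → ⟦ f ⟧ x ∈ adjoin V (⟦ f ⟧ b)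
      fU′⊑V′ (u , w , u∈U , (a , w≈) , x≈) =
        ⟦ f ⟧ u , ⟦ f ⟧ w , fU⊑V u∈U ,
        (a , N.≈ᴹ-trans (f.⟦⟧-cong w≈) (f.*ₗ-homo a b)) ,
        N.≈ᴹ-trans (f.⟦⟧-cong x≈) (f.+ᴹ-homo u w)

  idₗ : (M : V𝕊) → LinearMap 𝔽 M M
  idₗ M = mkLinear 𝔽 {M} {M} id id (λ _ _ → ≈ᴹ-refl) (λ _ _ → ≈ᴹ-refl)
    where open LeftModule M

  infixl 7 _⊓_

  _⊓_ : {M : V𝕊} → Subspace 𝔽 M → Subspace 𝔽 M → Subspace 𝔽 M
  U ⊓ W = _∩_ 𝔽 U W

  -- Dimension as a function on subspaces.

  module _ {M : V𝕊} (fd : FiniteDimensional 𝔽 M) where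
    finDim-spanned : (U W : Subspace 𝔽 M) → Spanned U W (proj₁ fd)
    finDim-spanned U W = spanned-mono {U = 𝟎} {U} {whole 𝔽 M} {W} (proj₁ fd) (𝟎-⊑ U)
      (λ _ → Subspace.0ᴹ-∈ (whole 𝔽 M))
      (flag⇒spanned {U = 𝟎} {whole 𝔽 M} (proj₁ fd) (hasDim⇒flag {U = whole 𝔽 M} (proj₂ fd)))

    -- The flag is found by excluded middle; `flag-unique` makes its length independent of the
    -- choices.
    dim : Subspace 𝔽 M → ℕ
    dim U = proj₁ (flag-exists {U = 𝟎} {U} (proj₁ fd) (finDim-spanned 𝟎 U))

    dim-flag : (U : Subspace 𝔽 M) → Flag 𝟎 U (dim U)
    dim-flag U = proj₂ (flag-exists {U = 𝟎} {U} (proj₁ fd) (finDim-spanned 𝟎 U))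

    dim-bounded : (U : Subspace 𝔽 M) → dim U ≤ proj₁ fd
    dim-bounded U = flag≤spanned {U = 𝟎} {U} (dim U) (proj₁ fd) (dim-flag U) (finDim-spanned 𝟎 U)

    dim-mono : (U W : Subspace 𝔽 M) → U ⊑ W → dim U ≤ dim W
    dim-mono U W U⊑W = flag-mono {U = 𝟎} {U} {W} U⊑W (dim-flag U) (dim-flag W)

    dim-cong : (U W : Subspace 𝔽 M) → U ⊑ W → W ⊑ U → dim U ≡ dim W
    dim-cong U W U⊑W W⊑U = ℕ.≤-antisym (dim-mono U W U⊑W) (dim-mono W U W⊑U)

    dim-additive : (U W : Subspace 𝔽 M) {k : ℕ} → U ⊑ W → Flag U W k → dim W ≡ dim U + k
    dim-additive U W {k} U⊑W f = flag-unique {U = 𝟎} {W} (dim-flag W)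
      (flag-trans {U = 𝟎} {U} {W} (dim U) k (𝟎-⊑ U) U⊑W (dim-flag U) f)

    dim-≥⇒⊒ : (U W : Subspace 𝔽 M) → U ⊑ W → dim W ≤ dim U → W ⊑ U
    dim-≥⇒⊒ U W U⊑W dimW≤dimU with flag-exists {U = U} {W} (proj₁ fd) (finDim-spanned U W)
    ... | zero  , f = f
    ... | suc k , f = contradiction
      (subst (_≤ dim U) (dim-additive U W {suc k} U⊑W f) dimW≤dimU) (ℕ.m+1+n≰m (dim U))

    -- The second isomorphism theorem: U / (U ∩ W) ≅ (U + W) / W, induced by the identity, so both
    -- flags have the same length k.
    dim-modular : (U W : Subspace 𝔽 M) → dim U + dim W ≡ dim (U ⊞ W) + dim (U ⊓ W)
    dim-modular U W with flag-exists {U = U ⊓ W} {U} (proj₁ fd) (finDim-spanned (U ⊓ W) U)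
    ... | k , f = begin
      dim U + dim W               ≡⟨ cong (_+ dim W) (dim-additive (U ⊓ W) U proj₁ f) ⟩
      (dim (U ⊓ W) + k) + dim W   ≡⟨ ℕ.+-assoc (dim (U ⊓ W)) k (dim W) ⟩
      dim (U ⊓ W) + (k + dim W)   ≡⟨ cong (dim (U ⊓ W) +_) (ℕ.+-comm k (dim W)) ⟩
      dim (U ⊓ W) + (dim W + k)   ≡⟨ cong (dim (U ⊓ W) +_) (dim-additive W (U ⊞ W) (⊞-⊒ʳ U W) g) ⟨
      dim (U ⊓ W) + dim (U ⊞ W)   ≡⟨ ℕ.+-comm (dim (U ⊓ W)) (dim (U ⊞ W)) ⟩
      dim (U ⊞ W) + dim (U ⊓ W)   ∎
      where
      open ≡-Reasoning
      g : Flag W (U ⊞ W) k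
      g = flag-map (idₗ M) {U ⊓ W} {U} {W} {U ⊞ W} k _,_ proj₂ (⊞-⊒ˡ U W)
        (λ (u , w , u∈U , w∈W , x≈) → w , u , w∈W , u∈U ,
          LeftModule.≈ᴹ-trans M x≈ (LeftModule.+ᴹ-comm M u w)) f

  module _ {M : V𝕊} where
    open LeftModule M
    open Sum +ᴹ-commutativeMonoid using () renaming (sum to sumᴹ)

    sum-∈ : ∀ {n} (T : Subspace 𝔽 M) (x : Fin n → Carrierᴹ) → (∀ k → x k ∈ T) → sumᴹ x ∈ T
    sum-∈ {zero}  T x x∈T = Subspace.0ᴹ-∈ T
    sum-∈ {suc n} T x x∈T = Subspace.+ᴹ-∈ T (x∈T zero) (sum-∈ T (x ∘ suc) (x∈T ∘ suc))

    sum-zero : ∀ {n} (x : Fin n → Carrierᴹ) → (∀ k → x k ≈ᴹ 0ᴹ) → sumᴹ x ≈ᴹ 0ᴹ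
    sum-zero x x≈0 = sum-∈ 𝟎 x x≈0

    sum-single : ∀ {n} (x : Fin n → Carrierᴹ) (k : Fin n) →
                 (∀ l → l ≢ k → x l ≈ᴹ 0ᴹ) → sumᴹ x ≈ᴹ x k
    sum-single x zero x≈0 = ≈ᴹ-trans
      (+ᴹ-congˡ (sum-zero (x ∘ suc) (λ l → x≈0 (suc l) λ ()))) (+ᴹ-identityʳ (x zero))
    sum-single x (suc k) x≈0 = ≈ᴹ-trans
      (+ᴹ-cong (x≈0 zero λ ()) (sum-single (x ∘ suc) k (λ l l≢k → x≈0 (suc l) (l≢k ∘ suc-injective))))
      (+ᴹ-identityˡ (x (suc k)))

  -- Finite direct sums and their dimension.

  module _ {I : Set} (fin : Finite I) (M : I → V𝕊) where
    private
      module M i = LeftModule (M i)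
      module ⨁M = LeftModule (⨁ 𝔽 M)
      ι = inject 𝔽 fin M
      elem = Inverse.from (proj₂ fin)
      index = Inverse.to (proj₂ fin)

    inject-same : ∀ i x → M._≈ᴹ_ i (⟦ ι i ⟧ x i) x
    inject-same i x with ≡-dec fin i i
    ... | yes refl = M.≈ᴹ-refl i
    ... | no  i≢i  = contradiction refl i≢i

    inject-other : ∀ {i j} x → i ≢ j → M._≈ᴹ_ j (⟦ ι i ⟧ x j) (M.0ᴹ j)
    inject-other {i} {j} x i≢j with ≡-dec fin i j
    ... | yes i≡j = contradiction i≡j i≢j
    ... | no  _   = M.≈ᴹ-refl j

    inject-∈ : (A : ∀ i → Subspace 𝔽 (M i)) → ∀ {i x} → x ∈ A i → ⟦ ι i ⟧ x ∈ ⨁ˢ 𝔽 A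
    inject-∈ A {i} {x} x∈A j with ≡-dec fin i j
    ... | yes refl = x∈A
    ... | no  _    = Subspace.0ᴹ-∈ (A j)

    inject-∈⁻¹ : (A : ∀ i → Subspace 𝔽 (M i)) → ∀ {i x} → ⟦ ι i ⟧ x ∈ ⨁ˢ 𝔽 A → x ∈ A i
    inject-∈⁻¹ A {i} {x} p = Subspace.∈-resp-≈ (A i) (inject-same i x) (p i)

    single-summand : {N : V𝕊} (y : I → LeftModule.Carrierᴹ N) (i : I) →
                     (∀ j → j ≢ i → LeftModule._≈ᴹ_ N (y j) (LeftModule.0ᴹ N)) →
                     LeftModule._≈ᴹ_ N (Sum.sum (LeftModule.+ᴹ-commutativeMonoid N) (y ∘ elem)) (y i)
    single-summand {N} y i y≈0 = ≈ᴹ-trans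
      (sum-single {N} (y ∘ elem) (index i)
        (λ l l≢ → y≈0 (elem l) (λ { refl → l≢ (sym (Inverse.strictlyInverseˡ (proj₂ fin) l)) })))
      (≈ᴹ-reflexive (cong y (Inverse.strictlyInverseʳ (proj₂ fin) i)))
      where open LeftModule N

    module _ {N : V𝕊} (f : ∀ i → LinearMap 𝔽 (M i) N) where
      private module N = LeftModule N

      copair-∈ : (T : Subspace 𝔽 N) (x : ∀ i → LeftModule.Carrierᴹ (M i)) →
                 (∀ i → ⟦ f i ⟧ (x i) ∈ T) → ⟦ copair 𝔽 fin M {N} f ⟧ x ∈ T
      copair-∈ T x fx∈T = sum-∈ {N} T (λ k → ⟦ f (elem k) ⟧ (x (elem k))) (fx∈T ∘ elem)

      copair-inject : ∀ i x → N._≈ᴹ_ (⟦ copair 𝔽 fin M {N} f ⟧ (⟦ ι i ⟧ x)) (⟦ f i ⟧ x)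
      copair-inject i x = N.≈ᴹ-trans
        (single-summand {N} (λ j → ⟦ f j ⟧ (⟦ ι i ⟧ x j)) i (λ j j≢i → N.≈ᴹ-trans
          (LinearMap.⟦⟧-cong (f j) (inject-other x (j≢i ∘ sym))) (LinearMap.0ᴹ-homo (f j))))
        (LinearMap.⟦⟧-cong (f i) (inject-same i x))

    sum-component : ∀ {n} (x : Fin n → ⨁M.Carrierᴹ) i →
                    M._≈ᴹ_ i (Sum.sum ⨁M.+ᴹ-commutativeMonoid x i)
                             (Sum.sum (M.+ᴹ-commutativeMonoid i) (λ k → x k i))
    sum-component {zero}  x i = M.≈ᴹ-refl i
    sum-component {suc n} x i = M.+ᴹ-congˡ i (sum-component (x ∘ suc) i)

    copair-injections : ∀ x → ⟦ copair 𝔽 fin M {⨁ 𝔽 M} ι ⟧ x ⨁M.≈ᴹ x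
    copair-injections x i = M.≈ᴹ-trans i
      (sum-component (λ k → ⟦ ι (elem k) ⟧ (x (elem k))) i)
      (M.≈ᴹ-trans i
        (single-summand {M i} (λ j → ⟦ ι j ⟧ (x j) i) i (λ j j≢i → inject-other (x j) j≢i))
        (inject-same i (x i)))

    module _ (A : ∀ i → Subspace 𝔽 (M i)) where

      -- The partial direct sums are taken inside the full one, so that indices can be added one at
      -- a time in a fixed ambient space.
      supportedOn : ∀ {n} → (Fin n → I) → Subspace 𝔽 (⨁ 𝔽 M)
      supportedOn es = ⨁ˢ 𝔽 A ⊓ record
        { Contains = λ x → ∀ i → (∀ k → es k ≢ i) → M._≈ᴹ_ i (x i) (M.0ᴹ i)
        ; ∈-resp-≈ = λ x≈y x≈0 i i∉ → M.≈ᴹ-trans i (M.≈ᴹ-sym i (x≈y i)) (x≈0 i i∉)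
        ; 0ᴹ-∈     = λ i _ → M.≈ᴹ-refl i
        ; +ᴹ-∈     = λ p q i i∉ → M.≈ᴹ-trans i (M.+ᴹ-cong i (p i i∉) (q i i∉)) (M.+ᴹ-identityˡ i _)
        ; *ₗ-∈     = λ a p i i∉ → M.≈ᴹ-trans i (M.*ₗ-congˡ i (p i i∉)) (M.*ₗ-zeroʳ i a)
        }

      -- Modulo the vectors supported on the remaining indices, those supported on all of `es` form
      -- a copy of A at the first index, embedded by `inject`. Injectivity of `es` keeps that index
      -- out of the rest.
      flag-supportedOn : (a : I → ℕ) → (∀ i → Flag 𝟎 (A i) (a i)) →
                         ∀ {n} (es : Fin n → I) → (∀ k l → es k ≡ es l → k ≡ l) →
                         Flag 𝟎 (supportedOn es) (sum (a ∘ es))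
      flag-supportedOn a flags {zero}  es inj = λ (_ , x≈0) i → x≈0 i λ ()
      flag-supportedOn a flags {suc n} es inj =
        subst (Flag 𝟎 (supportedOn es)) (ℕ.+-comm (sum (a ∘ es ∘ suc)) (a e₀))
          (flag-trans {U = 𝟎} {supportedOn (es ∘ suc)} {supportedOn es}
            (sum (a ∘ es ∘ suc)) (a e₀)
            (𝟎-⊑ (supportedOn (es ∘ suc)))
            (λ (x∈A , x≈0) → x∈A , λ i i∉ → x≈0 i (i∉ ∘ suc))
            (flag-supportedOn a flags (es ∘ suc) (λ k l → suc-injective ∘ inj (suc k) (suc l)))
            (flag-map (ι e₀) {𝟎} {A e₀} {supportedOn (es ∘ suc)} {supportedOn es} (a e₀)
              (λ {x} _ (_ , x≈0) → M.≈ᴹ-trans e₀ (M.≈ᴹ-sym e₀ (inject-same e₀ x))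
                (x≈0 e₀ e₀∉))
              (λ x≈0 → Subspace.∈-resp-≈ (supportedOn (es ∘ suc))
                (⨁M.≈ᴹ-sym (⨁M.≈ᴹ-trans (LinearMap.⟦⟧-cong (ι e₀) x≈0) (LinearMap.0ᴹ-homo (ι e₀))))
                (Subspace.0ᴹ-∈ (supportedOn (es ∘ suc))))
              (λ {x} x∈A → inject-∈ A x∈A , λ i i∉ → inject-other x (i∉ zero))
              decompose
              (flags e₀)))
        where
        e₀ = es zero
        e₀∉ : ∀ k → es (suc k) ≢ e₀
        e₀∉ k p with inj (suc k) zero p
        ... | ()

        decompose : ∀ {y} → y ∈ supportedOn es →
                    ∃[ v ] ∃[ x ] v ∈ supportedOn (es ∘ suc) × x ∈ A e₀ × y ⨁M.≈ᴹ (v ⨁M.+ᴹ ⟦ ι e₀ ⟧ x)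
        decompose {y} (y∈A , y≈0) =
          v , y e₀ , (Subspace.+ᴹ-∈ (⨁ˢ 𝔽 A) y∈A
            (Subspace.*ₗ-∈ (⨁ˢ 𝔽 A) (-ˢ 1#) (inject-∈ A (y∈A e₀))) , v≈0) , y∈A e₀ ,
          ⨁M.≈ᴹ-trans (⨁M.≈ᴹ-sym (-*ₗ-cancel {⨁ 𝔽 M} y 1# y₀))
            (⨁M.+ᴹ-congˡ (⨁M.*ₗ-identityˡ y₀))
          where
          y₀ = ⟦ ι e₀ ⟧ (y e₀)
          v = y ⨁M.+ᴹ ((-ˢ 1#) ⨁M.*ₗ y₀)

          v≈0 : ∀ i → (∀ k → es (suc k) ≢ i) → M._≈ᴹ_ i (v i) (M.0ᴹ i)
          v≈0 i i∉ with ≡-dec fin e₀ i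
          ... | yes refl = M.≈ᴹ-trans i
            (M.+ᴹ-congʳ i (M.≈ᴹ-sym i (M.*ₗ-identityˡ i (y i))))
            (-*ₗ-inverse {M i} 1# (y i))
          ... | no e₀≢i = M.≈ᴹ-trans i
            (M.+ᴹ-cong i (y≈0 i λ { zero → e₀≢i ; (suc k) → i∉ k }) (M.*ₗ-zeroʳ i (-ˢ 1#)))
            (M.+ᴹ-identityˡ i (M.0ᴹ i))

      flag-⨁ˢ : (a : I → ℕ) → (∀ i → Flag 𝟎 (A i) (a i)) → Flag 𝟎 (⨁ˢ 𝔽 A) (Σᶠ fin a)
      flag-⨁ˢ a flags = flag-resp {U = 𝟎} {𝟎} {supportedOn elem} {⨁ˢ 𝔽 A} (Σᶠ fin a) id id proj₁
        (λ x∈A → x∈A , λ i i∉ → contradiction (Inverse.strictlyInverseʳ (proj₂ fin) i) (i∉ (index i)))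
        (flag-supportedOn a flags elem
          (λ k l p → trans (sym (Inverse.strictlyInverseˡ (proj₂ fin) k))
            (trans (cong index p) (Inverse.strictlyInverseˡ (proj₂ fin) l))))

-- Families of vertex subspaces and their excess.

module Excess (lem : Classical) {ℓ : Level} (𝔽 : HeytingField ℓ ℓ ℓ) {G : Digraph} (F : Sheaf 𝔽 G) where
  open LinearAlgebra lem 𝔽
  open Digraph G
  open Sheaf F

  Family : Set (Level.suc ℓ)
  Family = ∀ v → Subspace 𝔽 (atVertex v)

  Γₑ : ∀ e → Subspace 𝔽 (atVertex (tail e)) → Subspace 𝔽 (atVertex (head e)) →
       Subspace 𝔽 (atEdge e)
  Γₑ e A B = preimage 𝔽 (restrictTail e) A ⊓ preimage 𝔽 (restrictHead e) B

  γ : ∀ e → Subspace 𝔽 (atVertex (tail e)) → Subspace 𝔽 (atVertex (head e)) → ℕ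
  γ e A B = dim (finDim-atEdge e) (Γₑ e A B)

  γ-cong : ∀ e {A A′ B B′} → A ⊑ A′ → A′ ⊑ A → B ⊑ B′ → B′ ⊑ B → γ e A B ≡ γ e A′ B′
  γ-cong e {A} {A′} {B} {B′} A⊑A′ A′⊑A B⊑B′ B′⊑B = dim-cong (finDim-atEdge e) (Γₑ e A B) (Γₑ e A′ B′)
    (λ (p , q) → A⊑A′ p , B⊑B′ q) (λ (p , q) → A′⊑A p , B′⊑B q)

  -- The modular law is applied to the two edge subspaces. Their sum only embeds in the edge
  -- subspace of the sums, since a vector with ends in A + A′ and B + B′ need not split; hence an
  -- inequality.
  γ-supermodular : ∀ e A B A′ B′ → γ e A B + γ e A′ B′ ≤ γ e (A ⊞ A′) (B ⊞ B′) + γ e (A ⊓ A′) (B ⊓ B′)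
  γ-supermodular e A B A′ B′ = ℕ.≤-trans (ℕ.≤-reflexive (dim-modular fd X Y)) (ℕ.+-mono-≤
    (dim-mono fd (X ⊞ Y) Z (⊞-least X Y Z
      (λ (p , q) → ⊞-⊒ˡ A A′ p , ⊞-⊒ˡ B B′ q) (λ (p , q) → ⊞-⊒ʳ A A′ p , ⊞-⊒ʳ B B′ q)))
    (dim-mono fd (X ⊓ Y) (Γₑ e (A ⊓ A′) (B ⊓ B′)) (λ ((p , q) , (p′ , q′)) → (p , p′) , (q , q′))))
    where
    fd = finDim-atEdge e
    X = Γₑ e A B
    Y = Γₑ e A′ B′
    Z = Γₑ e (A ⊞ A′) (B ⊞ B′)

  vdim : ∀ v → Subspace 𝔽 (atVertex v) → ℕ
  vdim v = dim (finDim-atVertex v)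

  edges : Family → ℕ
  edges A = Σᶠ finiteEdge (λ e → γ e (A (tail e)) (A (head e)))

  vertices : Family → ℕ
  vertices A = Σᶠ finiteVertex (λ v → vdim v (A v))

  edges-cong : ∀ A B → (∀ v → A v ⊑ B v) → (∀ v → B v ⊑ A v) → edges A ≡ edges B
  edges-cong A B A⊑B B⊑A = Σᶠ-cong finiteEdge (λ e → γ-cong e
    {A (tail e)} {B (tail e)} {A (head e)} {B (head e)}
    (A⊑B (tail e)) (B⊑A (tail e)) (A⊑B (head e)) (B⊑A (head e)))

  _⊕_ _⊗_ : Family → Family → Family
  (A ⊕ B) v = A v ⊞ B v
  (A ⊗ B) v = A v ⊓ B v

  edges-supermodular : ∀ A B → edges A + edges B ≤ edges (A ⊕ B) + edges (A ⊗ B)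
  edges-supermodular A B = subst₂ _≤_
    (Σᶠ-+ finiteEdge (γ′ A) (γ′ B)) (Σᶠ-+ finiteEdge (γ′ (A ⊕ B)) (γ′ (A ⊗ B)))
    (Σᶠ-mono finiteEdge (λ e → γ-supermodular e (A (tail e)) (A (head e)) (B (tail e)) (B (head e))))
    where
    γ′ : Family → Edge → ℕ
    γ′ A e = γ e (A (tail e)) (A (head e))

  vertices-modular : ∀ A B → vertices A + vertices B ≡ vertices (A ⊕ B) + vertices (A ⊗ B)
  vertices-modular A B = trans (sym (Σᶠ-+ finiteVertex (vdim′ A) (vdim′ B))) (trans
    (Σᶠ-cong finiteVertex (λ v → dim-modular (finDim-atVertex v) (A v) (B v)))
    (Σᶠ-+ finiteVertex (vdim′ (A ⊕ B)) (vdim′ (A ⊗ B))))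
    where
    vdim′ : Family → Vertex → ℕ
    vdim′ A v = vdim v (A v)

  -- The inequality between the excesses of A and B, freed of subtraction.
  infix 4 _≼_
  _≼_ : Family → Family → Set
  A ≼ B = edges A + vertices B ≤ edges B + vertices A

  Maximal : Family → Set (Level.suc ℓ)
  Maximal A = ∀ B → B ≼ A

  maximal-⊕ : ∀ A B → Maximal A → Maximal B → Maximal (A ⊕ B)
  maximal-⊕ A B maxA maxB C =
    uncross (edges A) (vertices A) (edges B) (vertices B)
      (edges (A ⊕ B)) (vertices (A ⊕ B)) (edges (A ⊗ B)) (vertices (A ⊗ B)) (edges C) (vertices C)
      (edges-supermodular A B) (vertices-modular A B) (maxA (A ⊗ B)) (maxB C)

  -- Excess may be negative, so the minimised quantity is the total edge dimension minus the excess,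
  -- a natural number. The zero family only starts the descent.
  maximal-exists : ∃[ A ] Maximal A
  maximal-exists =
    let A , A-minimises = minimiser lem (λ A → (bound ∸ edges A) + vertices A) (λ v → 𝟎)
    in A , λ B → defect-≤ bound (edges≤bound A) (edges≤bound B) (A-minimises B)
    where
    bound = Σᶠ finiteEdge (λ e → proj₁ (finDim-atEdge e))
    edges≤bound : ∀ A → edges A ≤ bound
    edges≤bound A = Σᶠ-mono finiteEdge (λ e → dim-bounded (finDim-atEdge e) (Γₑ e (A (tail e)) (A (head e))))

  vertices-bound : ℕ
  vertices-bound = Σᶠ finiteVertex (λ v → proj₁ (finDim-atVertex v))

  vertices-bounded : ∀ A → vertices A ≤ vertices-bound
  vertices-bounded A = Σᶠ-mono finiteVertex (λ v → dim-bounded (finDim-atVertex v) (A v))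

  ⊕-vertices-≤⇒⊑ : ∀ A B → vertices (A ⊕ B) ≤ vertices A → ∀ v → B v ⊑ A v
  ⊕-vertices-≤⇒⊑ A B p v {x} x∈ = dim-≥⇒⊒ (finDim-atVertex v) (A v) (A v ⊞ B v) (⊞-⊒ˡ (A v) (B v))
    (Σᶠ-squeeze finiteVertex {λ v → vdim v (A v)} {λ v → vdim v (A v ⊞ B v)}
      (λ v → dim-mono (finDim-atVertex v) (A v) (A v ⊞ B v) (⊞-⊒ˡ (A v) (B v))) p v)
    (⊞-⊒ʳ (A v) (B v) x∈)

  -- Among maximal families take one of greatest total vertex dimension. Adding another maximal B
  -- keeps it maximal, so the total cannot grow and B was already contained in it.
  largest-maximal : ∃[ A ] Maximal A × (∀ B → Maximal B → ∀ v → B v ⊑ A v)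
  largest-maximal =
    let (A , maxA) , A-minimises = minimiser lem {X = ∃[ A ] Maximal A}
          (λ (A , _) → vertices-bound ∸ vertices A) maximal-exists
    in A , maxA , λ B maxB → ⊕-vertices-≤⇒⊑ A B (ℕ.∸-cancelʳ-≤
         {vertices (A ⊕ B)} {vertices A} {vertices-bound} (vertices-bounded (A ⊕ B))
         (A-minimises (A ⊕ B , maximal-⊕ A B maxA maxB)))

  -- Restricting U to its vertex components does not change Γht and can only lower its dimension.
  components : Subspace 𝔽 (vertexSum 𝔽 F) → Family
  components U v = preimage 𝔽 (inject 𝔽 finiteVertex atVertex v) U

  ⨁-components : ∀ U → ⨁ˢ 𝔽 (components U) ⊑ U
  ⨁-components U {x} p = Subspace.∈-resp-≈ U (copair-injections finiteVertex atVertex x)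
    (copair-∈ finiteVertex atVertex (inject 𝔽 finiteVertex atVertex) U x p)

  -- On the summand at e, `d-head` is restriction followed by injection at `head e`, so
  -- `d-head w ∈ U` tests only the component of U there; likewise for tails.
  Γht-flag : ∀ U → Flag 𝟎 (Γht 𝔽 F U) (edges (components U))
  Γht-flag U = flag-⨁ˢ finiteEdge atEdge summand (λ e → γ e (A (tail e)) (A (head e))) (λ e →
    flag-resp {U = 𝟎} {𝟎} {Γₑ e (A (tail e)) (A (head e))} {summand e} (γ e (A (tail e)) (A (head e))) id id
      (λ {x} (p , q) → U.∈-resp-≈ (V.≈ᴹ-sym (d-head-inject e x)) q ,
                       U.∈-resp-≈ (V.≈ᴹ-sym (d-tail-inject e x)) p)
      (λ {x} (q , p) → U.∈-resp-≈ (d-tail-inject e x) p , U.∈-resp-≈ (d-head-inject e x) q)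
      (dim-flag (finDim-atEdge e) (Γₑ e (A (tail e)) (A (head e)))))
    where
    module U = Subspace U
    module V = LeftModule (vertexSum 𝔽 F)
    A = components U

    headInjection : ∀ e → LinearMap 𝔽 (atEdge e) (vertexSum 𝔽 F)
    headInjection e = _∘ₗ_ 𝔽 (inject 𝔽 finiteVertex atVertex (head e)) (restrictHead e)

    tailInjection : ∀ e → LinearMap 𝔽 (atEdge e) (vertexSum 𝔽 F)
    tailInjection e = _∘ₗ_ 𝔽 (inject 𝔽 finiteVertex atVertex (tail e)) (restrictTail e)

    d-head-inject = copair-inject finiteEdge atEdge {vertexSum 𝔽 F} headInjection
    d-tail-inject = copair-inject finiteEdge atEdge {vertexSum 𝔽 F} tailInjection

    summand : ∀ e → Subspace 𝔽 (atEdge e)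
    summand e = preimage 𝔽 (_∘ₗ_ 𝔽 (d-head 𝔽 F) (inject 𝔽 finiteEdge atEdge e)) U ⊓
                preimage 𝔽 (_∘ₗ_ 𝔽 (d-tail 𝔽 F) (inject 𝔽 finiteEdge atEdge e)) U

  ⨁ˢ-flag : ∀ A → Flag 𝟎 (⨁ˢ 𝔽 A) (vertices A)
  ⨁ˢ-flag A = flag-⨁ˢ finiteVertex atVertex A (λ v → vdim v (A v))
    (λ v → dim-flag (finDim-atVertex v) (A v))

  Γht-⨁ˢ-flag : ∀ A → Flag 𝟎 (Γht 𝔽 F (⨁ˢ 𝔽 A)) (edges A)
  Γht-⨁ˢ-flag A = subst (Flag 𝟎 (Γht 𝔽 F (⨁ˢ 𝔽 A)))
    (edges-cong (components (⨁ˢ 𝔽 A)) A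
      (λ v → inject-∈⁻¹ finiteVertex atVertex A) (λ v → inject-∈ finiteVertex atVertex A))
    (Γht-flag (⨁ˢ 𝔽 A))

  excess : Family → ℤ
  excess A = ℤ.+ edges A ℤ.- ℤ.+ vertices A

  hasExcess : ∀ A → HasExcess 𝔽 F (⨁ˢ 𝔽 A) (excess A)
  hasExcess A = edges A , vertices A , flag⇒hasDim {U = Γht 𝔽 F (⨁ˢ 𝔽 A)} (Γht-⨁ˢ-flag A) ,
    flag⇒hasDim {U = ⨁ˢ 𝔽 A} (⨁ˢ-flag A) , refl

  hasExcess-unique : ∀ A x → HasExcess 𝔽 F (⨁ˢ 𝔽 A) x → x ≡ excess A
  hasExcess-unique A x (a , b , dimΓ , dimU , x≡) = trans x≡ (cong₂ (λ a b → ℤ.+ a ℤ.- ℤ.+ b)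
    (flag-unique {U = 𝟎} {Γht 𝔽 F (⨁ˢ 𝔽 A)} (hasDim⇒flag {U = Γht 𝔽 F (⨁ˢ 𝔽 A)} dimΓ) (Γht-⨁ˢ-flag A))
    (flag-unique {U = 𝟎} {⨁ˢ 𝔽 A} (hasDim⇒flag {U = ⨁ˢ 𝔽 A} dimU) (⨁ˢ-flag A)))

  hasExcess-≤ : ∀ U x → HasExcess 𝔽 F U x → x ℤ.≤ excess (components U)
  hasExcess-≤ U x (a , b , dimΓ , dimU , x≡) = subst (ℤ._≤ excess (components U)) (sym x≡)
    (⊖-mono a b (edges (components U)) (vertices (components U)) (ℕ.+-mono-≤
      (ℕ.≤-reflexive (flag-unique {U = 𝟎} {Γht 𝔽 F U} (hasDim⇒flag {U = Γht 𝔽 F U} dimΓ) (Γht-flag U)))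
      (flag-mono {U = 𝟎} {⨁ˢ 𝔽 (components U)} {U} (⨁-components U)
        (⨁ˢ-flag (components U)) (hasDim⇒flag {U = U} dimU))))

  maximal⇒isMaxExcess : ∀ A → Maximal A → IsMaxExcess 𝔽 F (excess A)
  maximal⇒isMaxExcess A maxA = (⨁ˢ 𝔽 A , hasExcess A) , λ U x p →
    ℤ.≤-trans (hasExcess-≤ U x p)
      (⊖-mono (edges (components U)) (vertices (components U)) (edges A) (vertices A) (maxA (components U)))

  isMaxExcess⇒maximal : ∀ A {m} → IsMaxExcess 𝔽 F m → HasExcess 𝔽 F (⨁ˢ 𝔽 A) m → Maximal A
  isMaxExcess⇒maximal A {m} (_ , m-max) p B =
    ⊖-mono⁻¹ (edges B) (vertices B) (edges A) (vertices A)
      (subst (excess B ℤ.≤_) (hasExcess-unique A m p) (m-max (⨁ˢ 𝔽 B) (excess B) (hasExcess B)))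

-- Averaging over permutations, and sums along fibres.

uncross-cover : ∀ N {E V eM vM eB vB} → E + N ℕ.* vB ≤ N ℕ.* eB + V → eB + vM ≤ eM + vB →
                E + N ℕ.* vM ≤ N ℕ.* eM + V
uncross-cover N {E} {V} {eM} {vM} {eB} {vB} A≼B B≼M = ℕ.+-cancelʳ-≤ (N ℕ.* vB) _ _ (begin
  (E + N ℕ.* vM) + N ℕ.* vB ≡⟨ s₁ E (N ℕ.* vM) (N ℕ.* vB) ⟩
  (E + N ℕ.* vB) + N ℕ.* vM ≤⟨ ℕ.+-monoˡ-≤ (N ℕ.* vM) A≼B ⟩
  (N ℕ.* eB + V) + N ℕ.* vM ≡⟨ s₂ N eB V vM ⟩
  N ℕ.* (eB + vM) + V       ≤⟨ ℕ.+-monoˡ-≤ V (ℕ.*-monoʳ-≤ N B≼M) ⟩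
  N ℕ.* (eM + vB) + V       ≡⟨ s₃ N eM V vB ⟩
  (N ℕ.* eM + V) + N ℕ.* vB ∎)
  where
  open ℕ.≤-Reasoning
  open import Data.Nat.Tactic.RingSolver using (solve-∀)
  s₁ : ∀ a b c → (a + b) + c ≡ (a + c) + b
  s₁ = solve-∀
  s₂ : ∀ n a b c → (n ℕ.* a + b) + n ℕ.* c ≡ n ℕ.* (a + c) + b
  s₂ = solve-∀
  s₃ : ∀ n a b c → n ℕ.* (a + c) + b ≡ (n ℕ.* a + b) + n ℕ.* c
  s₃ = solve-∀

size-nonZero : {I : Set} (fin : Finite I) → I → ℕ.NonZero (size fin)
size-nonZero (zero  , e) i with Inverse.to e i
... | ()
size-nonZero (suc n , e) i = _

-- After exchanging sums, each fixed p merely permutes the sheets, so the sum over i is the same for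
-- every p.
Σᶠ-decode : ∀ {d} {I : Set} (fin : Finite I) (g : I → Fin d → ℕ) →
            Σᶠ (Fin-finite d) (λ i → Σᶠ fin (λ x → Σᶠ (Lehmer-finite d) (λ p → g x (decode p ⟨$⟩ʳ i))))
            ≡ size (Lehmer-finite d) ℕ.* Σᶠ fin (λ x → Σᶠ (Fin-finite d) (g x))
Σᶠ-decode {d} fin g = begin
  Σᶠ D (λ i → Σᶠ fin (λ x → Σᶠ L (λ p → g x (decode p ⟨$⟩ʳ i))))
    ≡⟨ Σᶠ-comm D fin (λ i x → Σᶠ L (λ p → g x (decode p ⟨$⟩ʳ i))) ⟩
  Σᶠ fin (λ x → Σᶠ D (λ i → Σᶠ L (λ p → g x (decode p ⟨$⟩ʳ i))))
    ≡⟨ Σᶠ-cong fin (λ x → Σᶠ-comm D L (λ i p → g x (decode p ⟨$⟩ʳ i))) ⟩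
  Σᶠ fin (λ x → Σᶠ L (λ p → Σᶠ D (λ i → g x (decode p ⟨$⟩ʳ i))))
    ≡⟨ Σᶠ-cong fin (λ x → Σᶠ-cong L (λ p → sym (Σᶠ-reindex D D (decode p) (g x)))) ⟩
  Σᶠ fin (λ x → Σᶠ L (λ p → Σᶠ D (g x)))
    ≡⟨ Σᶠ-cong fin (λ x → Σᶠ-const L (Σᶠ D (g x))) ⟩
  Σᶠ fin (λ x → size L ℕ.* Σᶠ D (g x))
    ≡⟨ Σᶠ-* fin (size L) (λ x → Σᶠ D (g x)) ⟩
  size L ℕ.* Σᶠ fin (λ x → Σᶠ D (g x)) ∎
  where
  open ≡-Reasoning
  D = Fin-finite d
  L = Lehmer-finite d

fibre-≡ : {A B : Set} {f : A → B} {b : B} {x y : Fibre f b} → proj₁ x ≡ proj₁ y → x ≡ y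
fibre-≡ {x = _ , refl} {_ , refl} refl = refl

fibre-↔ : {A B : Set} (f : A → B) {d : ℕ} → (∀ b → Fibre f b ↔ Fin d) → (B × Fin d) ↔ A
fibre-↔ f β = mk↔ₛ′
  (λ (b , i) → proj₁ (Inverse.from (β b) i))
  (λ a → f a , Inverse.to (β (f a)) (a , refl))
  (λ a → cong proj₁ (Inverse.strictlyInverseʳ (β (f a)) (a , refl)))
  (λ (b , i) → trans (sheet (Inverse.from (β b) i)) (cong (b ,_) (Inverse.strictlyInverseˡ (β b) i)))
  where
  sheet : ∀ {b} (x : Fibre f b) →
          (f (proj₁ x) , Inverse.to (β (f (proj₁ x))) (proj₁ x , refl)) ≡ (b , Inverse.to (β b) x)
  sheet (a , refl) = refl

Σᶠ-fibre : {A B : Set} (finA : Finite A) (finB : Finite B) {f : A → B} {d : ℕ}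
           (β : ∀ b → Fibre f b ↔ Fin d) (g : A → ℕ) →
           Σᶠ finA g ≡ Σᶠ finB (λ b → Σᶠ (Fin-finite d) (λ i → g (proj₁ (Inverse.from (β b) i))))
Σᶠ-fibre finA finB {f} {d} β g = trans
  (Σᶠ-reindex finA (×-finite finB (Fin-finite d)) (fibre-↔ f β) g)
  (Σᶠ-× finB (Fin-finite d) (λ (b , i) → g (proj₁ (Inverse.from (β b) i))))

Σᶠ-constant-on-fibres : {A B : Set} (finA : Finite A) (finB : Finite B) {f : A → B} {d : ℕ} →
                        (∀ b → Fibre f b ↔ Fin d) → (g : B → ℕ) →
                        Σᶠ finA (g ∘ f) ≡ d ℕ.* Σᶠ finB g
Σᶠ-constant-on-fibres finA finB {f} {d} β g = begin
  Σᶠ finA (g ∘ f)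
    ≡⟨ Σᶠ-fibre finA finB β (g ∘ f) ⟩
  Σᶠ finB (λ b → Σᶠ (Fin-finite d) (λ i → g (f (proj₁ (Inverse.from (β b) i)))))
    ≡⟨ Σᶠ-cong finB (λ b → trans
         (Σᶠ-cong (Fin-finite d) (λ i → cong g (proj₂ (Inverse.from (β b) i))))
         (Σᶠ-const (Fin-finite d) (g b))) ⟩
  Σᶠ finB (λ b → d ℕ.* g b)
    ≡⟨ Σᶠ-* finB d g ⟩
  d ℕ.* Σᶠ finB g ∎
  where open ≡-Reasoning

-- Stated for an abstract end map s, to be used for both heads and tails.
module _ {V′ E′ V E : Set} {fV : V′ → V} {fE : E′ → E} {s′ : E′ → V′} {s : E → V}
         (com : ∀ e → fV (s′ e) ≡ s (fE e)) where

  endFibre : ∀ {e} → Fibre fE e → Fibre fV (s e)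
  endFibre (e′ , refl) = s′ e′ , com e′

  proj₁-endFibre : ∀ {e} (y : Fibre fE e) → proj₁ (endFibre y) ≡ s′ (proj₁ y)
  proj₁-endFibre (e′ , refl) = refl

  -- Unfolds to `onHeads` and `onTails`, so the covering conditions apply as they stand.
  onEnds : ∀ v → Fibre s′ v → Fibre s (fV v)
  onEnds v (e , p) = fE e , trans (sym (com e)) (cong fV p)

  -- Unique lifting: at each vertex over `s e`, the covering condition provides exactly one edge
  -- over e with that end.
  endFibre-↔ : (∀ v → Bijective _≡_ _≡_ (onEnds v)) → ∀ e → Fibre fE e ↔ Fibre fV (s e)
  endFibre-↔ bij e = mk↔ₛ′ endFibre lift endFibre-lift
    (λ y → endFibre-injective (endFibre-lift (endFibre y)))
    where
    preimg : ((v , p) : Fibre fV (s e)) → ∃[ x ] onEnds v x ≡ (e , sym p)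
    preimg (v , p) = let x , eq = proj₂ (bij v) (e , sym p) in x , eq refl

    lift : Fibre fV (s e) → Fibre fE e
    lift x = proj₁ (proj₁ (preimg x)) , cong proj₁ (proj₂ (preimg x))

    endFibre-lift : ∀ x → endFibre (lift x) ≡ x
    endFibre-lift x = fibre-≡ (trans (proj₁-endFibre (lift x)) (proj₂ (proj₁ (preimg x))))

    endFibre-injective : ∀ {y z} → endFibre y ≡ endFibre z → y ≡ z
    endFibre-injective {e₁ , p₁} {e₂ , p₂} eq = fibre-≡ (cong proj₁
      (proj₁ (bij (s′ e₁)) {e₁ , refl} {e₂ , s₂≡s₁} (fibre-≡ (trans p₁ (sym p₂)))))
      where
      s₂≡s₁ : s′ e₂ ≡ s′ e₁
      s₂≡s₁ = trans (sym (proj₁-endFibre (e₂ , p₂))) (trans (sym (cong proj₁ eq)) (proj₁-endFibre (e₁ , p₁)))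

-- The Galois closure and the bound for a cover in sheet coordinates.

module _ (lem : Classical) {ℓ : Level} (𝔽 : HeytingField ℓ ℓ ℓ) {G : Digraph} (F : Sheaf 𝔽 G) where
  open LinearAlgebra lem 𝔽
  open Digraph G
  open Sheaf F
  private module F = Excess lem 𝔽 F

  -- The pullback of F to a graph with sheets P, written out directly: its ends project to those of
  -- G by definition, so no transport arises.
  module Twist {P : Set} (finP : Finite P) (t h : Edge → P → P) where

    graph : Digraph
    graph = record
      { Vertex       = Vertex × P
      ; Edge         = Edge × P
      ; finiteVertex = ×-finite finiteVertex finP
      ; finiteEdge   = ×-finite finiteEdge finP
      ; tail         = λ (e , p) → tail e , t e p
      ; head         = λ (e , p) → head e , h e p
      }

    sheaf : Sheaf 𝔽 graph
    sheaf = record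
      { atVertex        = λ (v , _) → atVertex v
      ; atEdge          = λ (e , _) → atEdge e
      ; finDim-atVertex = λ (v , _) → finDim-atVertex v
      ; finDim-atEdge   = λ (e , _) → finDim-atEdge e
      ; restrictTail    = λ (e , _) → restrictTail e
      ; restrictHead    = λ (e , _) → restrictHead e
      }

    open Excess lem 𝔽 sheaf public

    edges-Σ : ∀ A → edges A ≡
      Σᶠ finiteEdge (λ e → Σᶠ finP (λ p → F.γ e (A (tail e , t e p)) (A (head e , h e p))))
    edges-Σ A = Σᶠ-× finiteEdge finP (λ (e , p) → F.γ e (A (tail e , t e p)) (A (head e , h e p)))

    vertices-Σ : ∀ A → vertices A ≡ Σᶠ finiteVertex (λ v → Σᶠ finP (λ p → F.vdim v (A (v , p))))
    vertices-Σ A = Σᶠ-× finiteVertex finP (λ (v , p) → F.vdim v (A (v , p)))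

  -- The Galois closure of the d-sheeted cover with monodromy π (tails) and κ (heads): its sheets
  -- are permutations, and precomposition acts on it over G, transitively on fibres.
  module _ {d : ℕ} (π κ : Edge → Permutation′ d) where
    private
      L = Lehmer-finite d
      module T = Twist L (λ e → postcompose (π e)) (λ e → postcompose (κ e))

    translate : Permutation′ d → T.Family → T.Family
    translate τ A (v , p) = A (v , precompose τ p)

    -- By `compose-comm`, a translation carries the ends of a lifted edge to the ends of its
    -- translate, and it permutes the lifts of each edge.
    edges-translate : ∀ τ A → T.edges (translate τ A) ≡ T.edges A
    edges-translate τ A = begin
      T.edges (translate τ A)
        ≡⟨ T.edges-Σ (translate τ A) ⟩
      Σᶠ finiteEdge (λ e → Σᶠ L (λ p →
        g e (precompose τ (postcompose (π e) p)) (precompose τ (postcompose (κ e) p))))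
        ≡⟨ Σᶠ-cong finiteEdge (λ e → Σᶠ-cong L (λ p →
             cong₂ (g e) (sym (compose-comm (π e) τ p)) (sym (compose-comm (κ e) τ p)))) ⟩
      Σᶠ finiteEdge (λ e → Σᶠ L (λ p →
        g e (postcompose (π e) (precompose τ p)) (postcompose (κ e) (precompose τ p))))
        ≡⟨ Σᶠ-cong finiteEdge (λ e → Σᶠ-reindex L L (precompose-↔ τ)
             (λ p → g e (postcompose (π e) p) (postcompose (κ e) p))) ⟨
      Σᶠ finiteEdge (λ e → Σᶠ L (λ p → g e (postcompose (π e) p) (postcompose (κ e) p)))
        ≡⟨ T.edges-Σ A ⟨
      T.edges A ∎
      where
      open ≡-Reasoning
      g : Edge → Lehmer d → Lehmer d → ℕ
      g e p q = F.γ e (A (tail e , p)) (A (head e , q))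

    vertices-translate : ∀ τ A → T.vertices (translate τ A) ≡ T.vertices A
    vertices-translate τ A = begin
      T.vertices (translate τ A)
        ≡⟨ T.vertices-Σ (translate τ A) ⟩
      Σᶠ finiteVertex (λ v → Σᶠ L (λ p → F.vdim v (A (v , precompose τ p))))
        ≡⟨ Σᶠ-cong finiteVertex (λ v → Σᶠ-reindex L L (precompose-↔ τ) (λ p → F.vdim v (A (v , p)))) ⟨
      Σᶠ finiteVertex (λ v → Σᶠ L (λ p → F.vdim v (A (v , p))))
        ≡⟨ T.vertices-Σ A ⟨
      T.vertices A ∎
      where open ≡-Reasoning

    maximal-translate : ∀ τ A → T.Maximal A → T.Maximal (translate τ A)
    maximal-translate τ A maxA B = subst₂ (λ e v → T.edges B + v ≤ e + T.vertices B)
      (sym (edges-translate τ A)) (sym (vertices-translate τ A)) (maxA B)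

    private
      Λ : T.Family
      Λ = proj₁ T.largest-maximal

      -- The identity sheet is a base point; by `Λ-constant` every sheet gives the same subspaces.
      B : F.Family
      B v = Λ (v , encode Perm.id)

      -- Being the largest maximal family, Λ is invariant under translation, hence pulled back from G.
      Λ-constant : ∀ v p q → Λ (v , p) ⊑ Λ (v , q)
      Λ-constant v p q {x} x∈ =
        let τ , τq≡p = precompose-transitive q p
            _ , maxΛ , largest = T.largest-maximal
        in largest (translate τ Λ) (maximal-translate τ Λ maxΛ) (v , q)
             (subst (λ r → x ∈ Λ (v , r)) (sym τq≡p) x∈)

      edges-Λ : T.edges Λ ≡ size L ℕ.* F.edges B
      edges-Λ = begin
        T.edges Λ
          ≡⟨ T.edges-Σ Λ ⟩
        Σᶠ finiteEdge (λ e → Σᶠ L (λ p →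
          F.γ e (Λ (tail e , postcompose (π e) p)) (Λ (head e , postcompose (κ e) p))))
          ≡⟨ Σᶠ-cong finiteEdge (λ e → Σᶠ-cong L (λ p →
               F.γ-cong e {Λ (tail e , postcompose (π e) p)} {B (tail e)}
                         {Λ (head e , postcompose (κ e) p)} {B (head e)}
                 (Λ-constant (tail e) _ _) (Λ-constant (tail e) _ _)
                 (Λ-constant (head e) _ _) (Λ-constant (head e) _ _))) ⟩
        Σᶠ finiteEdge (λ e → Σᶠ L (λ p → γB e))
          ≡⟨ Σᶠ-cong finiteEdge (λ e → Σᶠ-const L (γB e)) ⟩
        Σᶠ finiteEdge (λ e → size L ℕ.* γB e)
          ≡⟨ Σᶠ-* finiteEdge (size L) γB ⟩
        size L ℕ.* F.edges B ∎
        where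
        open ≡-Reasoning
        γB : Edge → ℕ
        γB e = F.γ e (B (tail e)) (B (head e))

      vertices-Λ : T.vertices Λ ≡ size L ℕ.* F.vertices B
      vertices-Λ = begin
        T.vertices Λ
          ≡⟨ T.vertices-Σ Λ ⟩
        Σᶠ finiteVertex (λ v → Σᶠ L (λ p → F.vdim v (Λ (v , p))))
          ≡⟨ Σᶠ-cong finiteVertex (λ v → Σᶠ-cong L (λ p →
               dim-cong (finDim-atVertex v) (Λ (v , p)) (B v) (Λ-constant v _ _) (Λ-constant v _ _))) ⟩
        Σᶠ finiteVertex (λ v → Σᶠ L (λ p → F.vdim v (B v)))
          ≡⟨ Σᶠ-cong finiteVertex (λ v → Σᶠ-const L (F.vdim v (B v))) ⟩
        Σᶠ finiteVertex (λ v → size L ℕ.* F.vdim v (B v))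
          ≡⟨ Σᶠ-* finiteVertex (size L) (λ v → F.vdim v (B v)) ⟩
        size L ℕ.* F.vertices B ∎
        where open ≡-Reasoning

    -- A is compared with the largest family Λ, Λ with as many copies of B as there are
    -- permutations, and B with M on G.
    galois-bound : ∀ M → F.Maximal M → ∀ A →
                   T.edges A + size L ℕ.* F.vertices M ≤ size L ℕ.* F.edges M + T.vertices A
    galois-bound M maxM A = uncross-cover (size L) {T.edges A} {T.vertices A}
      {F.edges M} {F.vertices M} {F.edges B} {F.vertices B}
      (subst₂ (λ e v → T.edges A + v ≤ e + T.vertices A) edges-Λ vertices-Λ
        (proj₁ (proj₂ T.largest-maximal) A))
      (maxM B)

    module _ (A : ∀ v → Fin d → Subspace 𝔽 (atVertex v)) where
      private D = Fin-finite d

      -- The totals of a family on the d-sheeted cover in coordinates: the j-th lift of e runs from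
      -- sheet `π e ⟨$⟩ʳ j` to sheet `κ e ⟨$⟩ʳ j`.
      sheetEdges sheetVertices : ℕ
      sheetEdges = Σᶠ finiteEdge (λ e → Σᶠ D (λ j →
        F.γ e (A (tail e) (π e ⟨$⟩ʳ j)) (A (head e) (κ e ⟨$⟩ʳ j))))
      sheetVertices = Σᶠ finiteVertex (λ v → Σᶠ D (λ j → F.vdim v (A v j)))

      -- The d pullbacks of A along the projections p ↦ p i to the d-sheeted cover.
      pulled : Fin d → T.Family
      pulled i (v , p) = A v (decode p ⟨$⟩ʳ i)

      Σ-edges-pulled : Σᶠ D (λ i → T.edges (pulled i)) ≡ size L ℕ.* sheetEdges
      Σ-edges-pulled = trans
        (Σᶠ-cong D (λ i → trans (T.edges-Σ (pulled i))
          (Σᶠ-cong finiteEdge (λ e → Σᶠ-cong L (λ p → cong₂ (λ j k → F.γ e (A (tail e) j) (A (head e) k))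
            (decode-postcompose (π e) p i) (decode-postcompose (κ e) p i))))))
        (Σᶠ-decode finiteEdge (λ e j → F.γ e (A (tail e) (π e ⟨$⟩ʳ j)) (A (head e) (κ e ⟨$⟩ʳ j))))

      Σ-vertices-pulled : Σᶠ D (λ i → T.vertices (pulled i)) ≡ size L ℕ.* sheetVertices
      Σ-vertices-pulled = trans
        (Σᶠ-cong D (λ i → T.vertices-Σ (pulled i)))
        (Σᶠ-decode finiteVertex (λ v j → F.vdim v (A v j)))

      sheet-bound : ∀ M → F.Maximal M →
                    sheetEdges + d ℕ.* F.vertices M ≤ d ℕ.* F.edges M + sheetVertices
      -- The code of the identity shows that the cancelled factor is nonzero, also for d = 0, where
      -- it is 1.
      sheet-bound M maxM = ℕ.*-cancelˡ-≤ N {{size-nonZero L (encode Perm.id)}} (begin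
        N ℕ.* (sheetEdges + d ℕ.* F.vertices M)
          ≡⟨ distrib N sheetEdges d (F.vertices M) ⟩
        N ℕ.* sheetEdges + d ℕ.* (N ℕ.* F.vertices M)
          ≡⟨ cong₂ _+_ Σ-edges-pulled (Σᶠ-const D (N ℕ.* F.vertices M)) ⟨
        Σᶠ D (λ i → T.edges (pulled i)) + Σᶠ D (λ _ → N ℕ.* F.vertices M)
          ≡⟨ Σᶠ-+ D (λ i → T.edges (pulled i)) (λ _ → N ℕ.* F.vertices M) ⟨
        Σᶠ D (λ i → T.edges (pulled i) + N ℕ.* F.vertices M)
          ≤⟨ Σᶠ-mono D (λ i → galois-bound M maxM (pulled i)) ⟩
        Σᶠ D (λ i → N ℕ.* F.edges M + T.vertices (pulled i))
          ≡⟨ Σᶠ-+ D (λ _ → N ℕ.* F.edges M) (λ i → T.vertices (pulled i)) ⟩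
        Σᶠ D (λ _ → N ℕ.* F.edges M) + Σᶠ D (λ i → T.vertices (pulled i))
          ≡⟨ cong₂ _+_ (Σᶠ-const D (N ℕ.* F.edges M)) Σ-vertices-pulled ⟩
        d ℕ.* (N ℕ.* F.edges M) + N ℕ.* sheetVertices
          ≡⟨ distrib′ N sheetVertices d (F.edges M) ⟩
        N ℕ.* (d ℕ.* F.edges M + sheetVertices) ∎)
        where
        N = size L
        open ℕ.≤-Reasoning
        open import Data.Nat.Tactic.RingSolver using (solve-∀)
        distrib : ∀ n a d b → n ℕ.* (a + d ℕ.* b) ≡ n ℕ.* a + d ℕ.* (n ℕ.* b)
        distrib = solve-∀
        distrib′ : ∀ n a d b → d ℕ.* (n ℕ.* b) + n ℕ.* a ≡ n ℕ.* (d ℕ.* b + a)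
        distrib′ = solve-∀

-- The pullback sheaf, and its families in sheet coordinates.

module _ (lem : Classical) {ℓ : Level} (𝔽 : HeytingField ℓ ℓ ℓ) {G′ G : Digraph}
         (φ : Morphism G′ G) (F : Sheaf 𝔽 G) where
  open LinearAlgebra lem 𝔽
  open Digraph G
  open Sheaf F
  private
    module φ = Morphism φ
    module G′ = Digraph G′
    module F = Excess lem 𝔽 F
    module φ*F = Excess lem 𝔽 (pullback 𝔽 φ F)

  Subspaceᵛ : Vertex → Set (Level.suc ℓ)
  Subspaceᵛ v = Subspace 𝔽 (atVertex v)

  -- The restriction maps of the pullback are transported along `tail-com` and `head-com`; shifting
  -- the transport to the subspaces leaves `γ` of F itself.
  γ-pullback : ∀ e A B → φ*F.γ e A B ≡
               F.γ (φ.onEdge e) (subst Subspaceᵛ (φ.tail-com e) A) (subst Subspaceᵛ (φ.head-com e) B)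
  γ-pullback e A B = dim-cong (finDim-atEdge (φ.onEdge e)) (φ*F.Γₑ e A B)
    (F.Γₑ (φ.onEdge e) (subst Subspaceᵛ (φ.tail-com e) A) (subst Subspaceᵛ (φ.head-com e) B))
    (λ (p , q) → to (φ.tail-com e) (restrictTail _) A p , to (φ.head-com e) (restrictHead _) B q)
    (λ (p , q) → from (φ.tail-com e) (restrictTail _) A p , from (φ.head-com e) (restrictHead _) B q)
    where
    LinearMapᵛ : Vertex → Set ℓ
    LinearMapᵛ v = LinearMap 𝔽 (atEdge (φ.onEdge e)) (atVertex v)
    to : ∀ {u v} (p : u ≡ v) (r : LinearMapᵛ v) (U : Subspaceᵛ u) {x} →
         ⟦ subst LinearMapᵛ (sym p) r ⟧ x ∈ U → ⟦ r ⟧ x ∈ subst Subspaceᵛ p U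
    to refl _ _ x∈ = x∈
    from : ∀ {u v} (p : u ≡ v) (r : LinearMapᵛ v) (U : Subspaceᵛ u) {x} →
           ⟦ r ⟧ x ∈ subst Subspaceᵛ p U → ⟦ subst LinearMapᵛ (sym p) r ⟧ x ∈ U
    from refl _ _ x∈ = x∈

  pullbackFamily : F.Family → φ*F.Family
  pullbackFamily A v = A (φ.onVertex v)

  module _ {d : ℕ} (β : ∀ v → Fibre φ.onVertex v ↔ Fin d) (βᵉ : ∀ e → Fibre φ.onEdge e ↔ Fin d) where

    edges-pullbackFamily : ∀ A → φ*F.edges (pullbackFamily A) ≡ d ℕ.* F.edges A
    edges-pullbackFamily A = trans
      (Σᶠ-cong G′.finiteEdge (λ e → trans
        (γ-pullback e (A (φ.onVertex (G′.tail e))) (A (φ.onVertex (G′.head e))))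
        (cong₂ (F.γ (φ.onEdge e)) (dcong A (φ.tail-com e)) (dcong A (φ.head-com e)))))
      (Σᶠ-constant-on-fibres G′.finiteEdge finiteEdge βᵉ (λ e → F.γ e (A (tail e)) (A (head e))))

    vertices-pullbackFamily : ∀ A → φ*F.vertices (pullbackFamily A) ≡ d ℕ.* F.vertices A
    vertices-pullbackFamily A =
      Σᶠ-constant-on-fibres G′.finiteVertex finiteVertex β (λ v → F.vdim v (A v))

    excess-pullbackFamily : ∀ A → φ*F.excess (pullbackFamily A) ≡ ℤ.+ d ℤ.* F.excess A
    excess-pullbackFamily A = begin
      ℤ.+ φ*F.edges (pullbackFamily A) ℤ.- ℤ.+ φ*F.vertices (pullbackFamily A)
        ≡⟨ cong₂ (λ a b → ℤ.+ a ℤ.- ℤ.+ b) (edges-pullbackFamily A) (vertices-pullbackFamily A) ⟩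
      ℤ.+ (d ℕ.* F.edges A) ℤ.- ℤ.+ (d ℕ.* F.vertices A)
        ≡⟨ cong₂ ℤ._-_ (ℤ.pos-* d (F.edges A)) (ℤ.pos-* d (F.vertices A)) ⟩
      ℤ.+ d ℤ.* ℤ.+ F.edges A ℤ.- ℤ.+ d ℤ.* ℤ.+ F.vertices A
        ≡⟨ distrib (ℤ.+ d) (ℤ.+ F.edges A) (ℤ.+ F.vertices A) ⟩
      ℤ.+ d ℤ.* F.excess A ∎
      where
      open ≡-Reasoning
      open import Data.Integer.Tactic.RingSolver using (solve-∀)
      distrib : ∀ x y z → x ℤ.* y ℤ.- x ℤ.* z ≡ x ℤ.* (y ℤ.- z)
      distrib = solve-∀

    module _ (cov : IsCovering φ) where

      -- The numberings of edge fibres and vertex fibres are unrelated, so each end of e needs its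
      -- own permutation, from the number of a lifted edge to that of its end.
      tailMonodromy headMonodromy : Edge → Permutation′ d
      tailMonodromy e = β (tail e) ↔-∘
        (endFibre-↔ φ.tail-com (IsCovering.tails-bijective cov) e ↔-∘ ↔-sym (βᵉ e))
      headMonodromy e = β (head e) ↔-∘
        (endFibre-↔ φ.head-com (IsCovering.heads-bijective cov) e ↔-∘ ↔-sym (βᵉ e))

      module _ (A : φ*F.Family) where

        atFibre : ∀ {v} → Fibre φ.onVertex v → Subspaceᵛ v
        atFibre (v′ , p) = subst Subspaceᵛ p (A v′)

        atSheet : ∀ v → Fin d → Subspaceᵛ v
        atSheet v i = atFibre (Inverse.from (β v) i)

        atSheet-to : ∀ {v} (x : Fibre φ.onVertex v) → atFibre x ≡ atSheet v (Inverse.to (β v) x)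
        atSheet-to {v} x = cong atFibre (sym (Inverse.strictlyInverseʳ (β v) x))

        vertices-sheets : φ*F.vertices A ≡ sheetVertices lem 𝔽 F tailMonodromy headMonodromy atSheet
        vertices-sheets = trans
          (Σᶠ-fibre G′.finiteVertex finiteVertex β (λ v → φ*F.vdim v (A v)))
          (Σᶠ-cong finiteVertex (λ v → Σᶠ-cong (Fin-finite d) (λ i → vdim-atFibre (Inverse.from (β v) i))))
          where
          vdim-atFibre : ∀ {v} (x : Fibre φ.onVertex v) →
                         φ*F.vdim (proj₁ x) (A (proj₁ x)) ≡ F.vdim v (atFibre x)
          vdim-atFibre (_ , refl) = refl

        edges-sheets : φ*F.edges A ≡ sheetEdges lem 𝔽 F tailMonodromy headMonodromy atSheet
        edges-sheets = trans
          (Σᶠ-fibre G′.finiteEdge finiteEdge βᵉ (λ e → φ*F.γ e (A (G′.tail e)) (A (G′.head e))))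
          (Σᶠ-cong finiteEdge (λ e → Σᶠ-cong (Fin-finite d) (λ j → trans
            (γ-atFibre (Inverse.from (βᵉ e) j))
            (cong₂ (F.γ e) (atSheet-to _) (atSheet-to _)))))
          where
          γ-atFibre : ∀ {e} (y : Fibre φ.onEdge e) →
                      φ*F.γ (proj₁ y) (A (G′.tail (proj₁ y))) (A (G′.head (proj₁ y))) ≡
                      F.γ e (atFibre (endFibre φ.tail-com y)) (atFibre (endFibre φ.head-com y))
          γ-atFibre (e′ , refl) = γ-pullback e′ (A (G′.tail e′)) (A (G′.head e′))

      maximal-pullbackFamily : ∀ M → F.Maximal M → φ*F.Maximal (pullbackFamily M)
      maximal-pullbackFamily M maxM A = begin
        φ*F.edges A + φ*F.vertices (pullbackFamily M)
          ≡⟨ cong₂ _+_ (edges-sheets A) (vertices-pullbackFamily M) ⟩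
        sheetEdges lem 𝔽 F tailMonodromy headMonodromy (atSheet A) + d ℕ.* F.vertices M
          ≤⟨ sheet-bound lem 𝔽 F tailMonodromy headMonodromy (atSheet A) M maxM ⟩
        d ℕ.* F.edges M + sheetVertices lem 𝔽 F tailMonodromy headMonodromy (atSheet A)
          ≡⟨ cong₂ _+_ (edges-pullbackFamily M) (vertices-sheets A) ⟨
        φ*F.edges (pullbackFamily M) + φ*F.vertices A ∎
        where open ℕ.≤-Reasoning

-- From maximal families back to maximum excess.

open import Data.Integer.Base using (+_; _*_)

theorem1 : Classical → ∀ {ℓ} (𝔽 : HeytingField ℓ ℓ ℓ) {G′ G : Digraph}
    (φ : Morphism G′ G) → IsCovering φ → (d : ℕ) →
    (∀ v → Fibre (Morphism.onVertex φ) v ↔ Fin d) →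
    (∀ e → Fibre (Morphism.onEdge φ) e ↔ Fin d) →
    (F : Sheaf 𝔽 G) →
    (∃[ m ] IsMaxExcess 𝔽 F m × IsMaxExcess 𝔽 (pullback 𝔽 φ F) (+ d * m)) ×
    ((U : ∀ v → Subspace 𝔽 (Sheaf.atVertex F v)) →
    MaxExcessAttainedAt 𝔽 F (⨁ˢ 𝔽 U) →
    MaxExcessAttainedAt 𝔽 (pullback 𝔽 φ F) (⨁ˢ 𝔽 (λ v′ → U (Morphism.onVertex φ v′))))
theorem1 lem 𝔽 φ cov d β βᵉ F = maxima , attained
  where
  module F = Excess lem 𝔽 F
  module φ*F = Excess lem 𝔽 (pullback 𝔽 φ F)

  isMax : ∀ M → F.Maximal M → IsMaxExcess 𝔽 (pullback 𝔽 φ F) (φ*F.excess (pullbackFamily lem 𝔽 φ F M))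
  isMax M maxM = φ*F.maximal⇒isMaxExcess (pullbackFamily lem 𝔽 φ F M)
    (maximal-pullbackFamily lem 𝔽 φ F β βᵉ cov M maxM)

  maxima : ∃[ m ] IsMaxExcess 𝔽 F m × IsMaxExcess 𝔽 (pullback 𝔽 φ F) (+ d * m)
  maxima = let M , maxM = F.maximal-exists in
    F.excess M , F.maximal⇒isMaxExcess M maxM ,
    subst (IsMaxExcess 𝔽 (pullback 𝔽 φ F)) (excess-pullbackFamily lem 𝔽 φ F β βᵉ M) (isMax M maxM)

  attained : ∀ U → MaxExcessAttainedAt 𝔽 F (⨁ˢ 𝔽 U) →
             MaxExcessAttainedAt 𝔽 (pullback 𝔽 φ F) (⨁ˢ 𝔽 (pullbackFamily lem 𝔽 φ F U))
  attained U (m , m-max , U-attains) =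
    φ*F.excess (pullbackFamily lem 𝔽 φ F U) ,
    -- The given U is itself a maximal family, so its own pullback is maximal.
    isMax U (F.isMaxExcess⇒maximal U m-max U-attains) ,
    φ*F.hasExcess (pullbackFamily lem 𝔽 φ F U)
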